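{- Let $A$ and $B$ be strings of lengths $m$ and $n$, respectively, over a constant-size alphabet $\Sigma$, let $L=LCS(A,B)$ and $\Delta=n-L$. There is a data structure using $O(n)$ space that encodes the LCS score between $A$ and every substring of $B$ (that is, encodes the matrix $\mathcal{K}$) and supports both of the following update operations, in any order, each in $O(\Delta)$ time: prepending a character $\sigma\in\Sigma$ to $A$ (replacing $A$ by $\sigma A$) and appending a character $\sigma\in\Sigma$ to $A$ (replacing $A$ by $A\sigma$).
   Context: $LCS(X,Y)$ is the length of a longest common subsequence of the strings $X$ and $Y$. For a string $S=\sigma_1\cdots\sigma_n$, $S[i..j]=\sigma_{i+1}\cdots\sigma_j$. The matrix $\mathcal{K}$ is indexed by $[0:n]\times[0:n]$, with $\mathcal{K}[i,j]=LCS(B[i..j],A)$ if $i\le j$ and $\mathcal{K}[i,j]=j-i$ if $i>j$. For a matrix $\mathcal{D}$ over $[0:n]\times[0:m]$, its density matrix $\mathcal{D}^\square$ is the matrix over $[1:n]\times[1:m]$ with $\mathcal{D}^\square[i,j]=\mathcal{D}[i,j]+\mathcal{D}[i-1,j-1]-\mathcal{D}[i-1,j]-\mathcal{D}[i,j-1]$; its non-zero cells are called pivotal points. The matrix $\mathcal{K}$ is encoded by storing a list of the pivotal points of $\mathcal{K}^\square$; after each update the data structure must encode the matrix $\mathcal{K}$ of the current strings. Time bounds are worst case per operation, with $\Delta$ referring to the current strings. -}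

module Defs where

open import Data.Bool using (Bool; true; false; if_then_else_)
open import Data.Fin using (Fin; suc; toℕ; inject₁; _≤?_)
import Data.Fin.Properties as Fin
open import Data.Integer using (ℤ; +_; 0ℤ) renaming (_+_ to _+ᶻ_; _-_ to _-ᶻ_)
open import Data.List using (List; []; _∷_; _++_; length; map; filter; take; drop)
open import Data.List.Extrema.Nat using (max; argmax-sel; xs≤max)
open import Data.List.Membership.Propositional using (_∈_)
open import Data.List.Membership.Propositional.Properties
  using (∈-++⁺ˡ; ∈-++⁺ʳ; ∈-++⁻; ∈-map⁺; ∈-map⁻; ∈-filter⁺; ∈-filter⁻)
open import Data.List.Relation.Unary.All using (lookup)
open import Data.List.Relation.Unary.Any using (here)
open import Data.List.Relation.Unary.Unique.Propositional using (Unique)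
import Data.List.Relation.Binary.Sublist.DecPropositional as DecSublist
import Data.List.Relation.Binary.Sublist.Propositional.Properties as Sublist
open import Data.Nat using (ℕ; suc; _+_; _∸_; _<_; _≤_; _<ᵇ_; _≡ᵇ_)
open import Data.Product using (_×_; _,_; ∃)
open import Data.Sum using (inj₁; inj₂)
open import Data.Vec.Functional using (Vector; updateAt)
open import Function using (const)
open import Function.Bundles using (_⇔_)
open import Relation.Binary.PropositionalEquality using (_≡_; _≢_; refl; sym; subst)
open import Relation.Nullary.Decidable using (does)

String : ℕ → Set
String σ = List (Fin σ)

module _ {σ : ℕ} where

  open DecSublist (Fin._≟_ {σ}) using (_⊆_; _⊆?_; []; _∷_; _∷ʳ_; minimum)

  subsequences : String σ → List (String σ)
  subsequences []       = [] ∷ []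
  subsequences (x ∷ xs) = map (x ∷_) (subsequences xs) ++ subsequences xs

  commonSubsequences : String σ → String σ → List (String σ)
  commonSubsequences X Y = filter (_⊆? Y) (subsequences X)

  -- The default value 0 is harmless: [] is always a common subsequence.
  LCS : String σ → String σ → ℕ
  LCS X Y = max 0 (map length (commonSubsequences X Y))

  ∈-subsequences⁺ : ∀ {Z X : String σ} → Z ⊆ X → Z ∈ subsequences X
  ∈-subsequences⁺ []                = here refl
  ∈-subsequences⁺ {X = x ∷ X} (_ ∷ʳ p)    =
    ∈-++⁺ʳ (map (x ∷_) (subsequences X)) (∈-subsequences⁺ p)
  ∈-subsequences⁺ {X = x ∷ X} (refl ∷ p) = ∈-++⁺ˡ (∈-map⁺ (x ∷_) (∈-subsequences⁺ p))

  ∈-subsequences⁻ : ∀ {Z} (X : String σ) → Z ∈ subsequences X → Z ⊆ X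
  ∈-subsequences⁻ []      (here refl) = []
  ∈-subsequences⁻ (x ∷ X) Z∈ with ∈-++⁻ (map (x ∷_) (subsequences X)) Z∈
  ... | inj₂ q = x ∷ʳ ∈-subsequences⁻ X q
  ... | inj₁ q with ∈-map⁻ (x ∷_) q
  ...   | _ , q′ , refl = refl ∷ ∈-subsequences⁻ X q′

  LCS-upper : ∀ {X Y Z : String σ} → Z ⊆ X → Z ⊆ Y → length Z ≤ LCS X Y
  LCS-upper {X} {Y} p q =
    lookup (xs≤max 0 (map length (commonSubsequences X Y)))
           (∈-map⁺ length (∈-filter⁺ (_⊆? Y) (∈-subsequences⁺ p) q))

  LCS-attained : ∀ (X Y : String σ) → ∃ λ Z → Z ⊆ X × Z ⊆ Y × length Z ≡ LCS X Y
  LCS-attained X Y with argmax-sel (λ l → l) 0 (map length (commonSubsequences X Y))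
  ... | inj₁ eq = [] , minimum X , minimum Y , sym eq
  ... | inj₂ l∈ with ∈-map⁻ length l∈
  ...   | Z , Z∈ , eq with ∈-filter⁻ (_⊆? Y) {xs = subsequences X} Z∈
  ...     | Z∈X , q = Z , ∈-subsequences⁻ X Z∈X , q , sym eq

  LCS≤length : ∀ (X Y : String σ) → LCS X Y ≤ length Y
  LCS≤length X Y with LCS-attained X Y
  ... | _ , _ , q , eq = subst (_≤ length Y) eq (Sublist.length-mono-≤ q)

  -- No truncation occurs, by LCS≤length.
  Δ : String σ → String σ → ℕ
  Δ A B = length B ∸ LCS A B

-- S [ i ⋯ j ] consists of the characters of S at positions i+1, …, j, counting from 1.
_[_⋯_] : ∀ {σ} → String σ → ℕ → ℕ → String σ
S [ i ⋯ j ] = take (j ∸ i) (drop i S)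

-- A matrix over [0:n]×[0:m].
Matrix : ℕ → ℕ → Set
Matrix n m = Fin (suc n) → Fin (suc m) → ℤ

-- The density matrix lives over [1:n]×[1:m]; the index i : Fin n stands for the
-- coordinate i+1, so that  suc i  and  inject₁ i  are the coordinate and its predecessor.
density : ∀ {n m} → Matrix n m → Fin n → Fin m → ℤ
density D i j =
  (D (suc i) (suc j) +ᶻ D (inject₁ i) (inject₁ j)) -ᶻ D (inject₁ i) (suc j) -ᶻ D (suc i) (inject₁ j)

Pivotal : ∀ {n m} → Matrix n m → Fin n × Fin m → Set
Pivotal D (i , j) = density D i j ≢ 0ℤ

𝒦 : ∀ {σ} → String σ → (B : String σ) → Matrix (length B) (length B)
𝒦 A B i j = if does (i ≤? j)
  then + LCS (B [ toℕ i ⋯ toℕ j ]) A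
  else (+ toℕ j -ᶻ + toℕ i)

-- A unit-cost RAM, presented as a structured language.  It has k registers and a memory of
-- S cells; words hold the values 0, …, W-1.  The instruction set is that of the additive
-- RAM: constants, addition, truncated subtraction, comparisons and indirect addressing.

data Operand (k : ℕ) : Set where
  reg : Fin k → Operand k
  lit : ℕ → Operand k

data Expr (k : ℕ) : Set where
  val     : Operand k → Expr k
  _⊕_ _⊖_ : Operand k → Operand k → Expr k

data Test (k : ℕ) : Set where
  _≺_ _≐_ : Operand k → Operand k → Test k

data Cmd (k : ℕ) : Set where
  skip   : Cmd k
  _≔_    : Fin k → Expr k → Cmd k
  load   : Fin k → Operand k → Cmd k
  store  : Operand k → Operand k → Cmd k
  _⨾_    : Cmd k → Cmd k → Cmd k
  ifelse : Test k → Cmd k → Cmd k → Cmd k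
  while  : Test k → Cmd k → Cmd k

infix  6 _⊕_ _⊖_ _≺_ _≐_
infix  5 _≔_
infixr 4 _⨾_

record State (k : ℕ) : Set where
  constructor ⟨_,_⟩
  field
    regs : Vector ℕ k
    mem  : ℕ → ℕ

open State public

setReg : ∀ {k} → Fin k → ℕ → State k → State k
setReg x v s = ⟨ updateAt (regs s) x (const v) , mem s ⟩

setMem : ∀ {k} → ℕ → ℕ → State k → State k
setMem a v s = ⟨ regs s , (λ b → if a ≡ᵇ b then v else mem s b) ⟩

⟦_⟧ₒ : ∀ {k} → Operand k → State k → ℕ
⟦ reg x ⟧ₒ s = regs s x
⟦ lit v ⟧ₒ s = v

⟦_⟧ₑ : ∀ {k} → Expr k → State k → ℕ
⟦ val a ⟧ₑ s = ⟦ a ⟧ₒ s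
⟦ a ⊕ b ⟧ₑ s = ⟦ a ⟧ₒ s + ⟦ b ⟧ₒ s
⟦ a ⊖ b ⟧ₑ s = ⟦ a ⟧ₒ s ∸ ⟦ b ⟧ₒ s

⟦_⟧ₜ : ∀ {k} → Test k → State k → Bool
⟦ a ≺ b ⟧ₜ s = ⟦ a ⟧ₒ s <ᵇ ⟦ b ⟧ₒ s
⟦ a ≐ b ⟧ₜ s = ⟦ a ⟧ₒ s ≡ᵇ ⟦ b ⟧ₒ s

-- Run S W c s t s′: started in s, the command c halts in s′ after t steps.  An overflow
-- (a result not below W) or an access outside the S memory cells has no rule, so a run
-- is also a proof that neither happens.
data Run (S W : ℕ) {k : ℕ} : Cmd k → State k → ℕ → State k → Set where
  run-skip  : ∀ {s} → Run S W skip s 1 s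
  run-≔     : ∀ {s x e} → ⟦ e ⟧ₑ s < W →
              Run S W (x ≔ e) s 1 (setReg x (⟦ e ⟧ₑ s) s)
  run-load  : ∀ {s x a} → ⟦ a ⟧ₒ s < S →
              Run S W (load x a) s 1 (setReg x (mem s (⟦ a ⟧ₒ s)) s)
  run-store : ∀ {s a v} → ⟦ a ⟧ₒ s < S → ⟦ v ⟧ₒ s < W →
              Run S W (store a v) s 1 (setMem (⟦ a ⟧ₒ s) (⟦ v ⟧ₒ s) s)
  run-⨾     : ∀ {s s′ s″ t t′ c d} → Run S W c s t s′ → Run S W d s′ t′ s″ →
              Run S W (c ⨾ d) s (t + t′) s″
  run-then  : ∀ {s s′ t b c d} → ⟦ b ⟧ₜ s ≡ true → Run S W c s t s′ →
              Run S W (ifelse b c d) s (suc t) s′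
  run-else  : ∀ {s s′ t b c d} → ⟦ b ⟧ₜ s ≡ false → Run S W d s t s′ →
              Run S W (ifelse b c d) s (suc t) s′
  run-done  : ∀ {s b c} → ⟦ b ⟧ₜ s ≡ false → Run S W (while b c) s 1 s
  run-again : ∀ {s s′ s″ t t′ b c} → ⟦ b ⟧ₜ s ≡ true → Run S W c s t s′ →
              Run S W (while b c) s′ t′ s″ →
              Run S W (while b c) s (suc (t + t′)) s″

-- Cells at addresses S and above are never accessible, so they need no bound.
Fits : ℕ → ℕ → ∀ {k} → State k → Set
Fits S W s = (∀ x → regs s x < W) × (∀ a → a < S → mem s a < W)

-- A null-terminated singly linked list of points in the first S cells.  A node at address p
-- occupies cells p, p+1, p+2: the two coordinates (1-based) and the address of the next node.
-- Nodes may carry further cells, and the order of the list is up to the data structure.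
data LinkedList (S : ℕ) (μ : ℕ → ℕ) {n m : ℕ} : ℕ → List (Fin n × Fin m) → Set where
  nil  : LinkedList S μ 0 []
  node : ∀ {p i j ps} → 0 < p → p + 2 < S →
         μ p ≡ suc (toℕ i) → μ (p + 1) ≡ suc (toℕ j) → LinkedList S μ (μ (p + 2)) ps →
         LinkedList S μ p ((i , j) ∷ ps)

-- The list of the pivotal points of D's density matrix is stored from address p on.
Encodes : ℕ → (ℕ → ℕ) → ℕ → ∀ {n m} → Matrix n m → Set
Encodes S μ p {n} {m} D = ∃ λ (ps : List (Fin n × Fin m)) →
  LinkedList S μ p ps × Unique ps × (∀ q → (q ∈ ps) ⇔ Pivotal D q)

-- The code of a data structure over the alphabet Fin σ.  The argument of an update is passed
-- in register  arg , and register  head  points to the stored list.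
record UpdatePrograms : Set where
  field
    k       : ℕ
    arg     : Fin k
    head    : Fin k
    prepend : Cmd k
    append  : Cmd k

{-
A column j carries the row p j of its pivotal point, or 0, and LCS (B [ i ⋯ j ]) A = j - i - #{ b ≤ j : i < p b },
so Δ of the columns carry a nonzero row.  Appending x to A sends one more horizontal strand through the columns:
the hand holds 0 at first, and at column j it exchanges its row with p j if B_j = x or p j is smaller.  By the
recurrence of the LCS, the new LCS (B [ i ⋯ j ]) exceeds the old one by 1 exactly if the hand holds a row above i
after column j.  A column with row 0 that meets an empty hand does nothing, and the first such column after a pivotal
one takes over whatever the hand holds; so a walk along the sorted list of the nonzero columns suffices.

Prepending is appending for the reversed strings.  The structure therefore keeps two sorted lists, by columns for
(A, B) and by columns for the reversals; the pivotal points of the second are those of the first rotated by 180°.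
Appending only deletes one node from the second list, the one whose row leaves on the right, so each update
walks both lists once.
-}
module Submission where

open import Defs
open import Data.Bool using (Bool; true; false; if_then_else_; _∨_)
open import Data.Bool.Properties using (T-≡)
open import Data.Empty using (⊥; ⊥-elim)
open import Data.Fin using (Fin; toℕ; zero; suc; #_; fromℕ<; inject₁)
import Data.Fin.Properties as Fin
open import Data.Integer using () renaming (+_ to ⁺_; _-_ to _-ᶻ_)
import Data.Integer.Properties as ℤ
import Data.Integer.Solver as ℤ
open import Data.List using (List; []; _∷_; _∷ʳ_; _++_; length; reverse)
import Data.List as List
import Data.List.Properties as List
open import Data.List.Membership.Propositional using (_∈_)
open import Data.List.Relation.Binary.Sublist.Propositional using (_⊆_; []; _∷_)
import Data.List.Relation.Binary.Sublist.Propositional as Sublist using (_∷ʳ_)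
import Data.List.Relation.Binary.Sublist.Propositional.Properties as Sublist
import Data.List.Relation.Unary.All as All
open import Data.List.Relation.Unary.AllPairs using ([]; _∷_)
open import Data.List.Relation.Unary.Any using (here; there)
open import Data.List.Relation.Unary.Unique.Propositional using (Unique)
open import Data.Nat
open import Data.Nat.Divisibility using (n∣m*n)
open import Data.Nat.DivMod
open import Data.Nat.Properties
import Data.Nat.Solver as ℕ
open import Data.Product using (_×_; _,_; proj₁; proj₂; ∃; Σ-syntax)
open import Data.Sum using (_⊎_; inj₁; inj₂)
open import Data.Vec.Functional using (Vector; updateAt)
open import Data.Vec.Functional.Properties using (updateAt-minimal)
open import Function using (const)
open import Function.Bundles using (Equivalence; _⇔_; mk⇔)
open import Relation.Binary.PropositionalEquality
open import Relation.Nullary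
open import Relation.Nullary.Decidable using (dec-true; dec-false)

-- The obstacle is that pivotal points must be accessible from both sides: combing visits them by
-- columns, and for the reversed strings the columns are the old rows. Since reversal takes the
-- substring from i to j to the one from n - j to n - i, the point in row r and column j reappears
-- in row n + 1 - j and column n + 1 - r. Each half of the memory is therefore an array of nodes
-- indexed by column with a list threaded through it; the mirrored node is reached by address
-- arithmetic, and the walk along one list keeps the rows of the other up to date. Which columns the
-- second list contains after an update is settled by counting: combing permutes the rows, together
-- with the 0 that enters and the row that leaves, so only the column that mirrors the leaving row
-- drops out. Combing from the left is never described: the new function of the second half is known
-- to exist, and its values are read off the first.

-- Recurrences of the LCS

module _ {σ : ℕ} where

  LCS-mono : {X X′ Y Y′ : String σ} →
             (∀ {Z} → Z ⊆ X → Z ⊆ Y → ∃ λ Z′ → Z′ ⊆ X′ × Z′ ⊆ Y′ × length Z ≤ length Z′) →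
             LCS X Y ≤ LCS X′ Y′
  LCS-mono {X} {X′} {Y} {Y′} f with LCS-attained X Y
  ... | Z , a , b , eq with f a b
  ...   | Z′ , a′ , b′ , le = subst (_≤ LCS X′ Y′) eq (≤-trans le (LCS-upper a′ b′))

  LCS-sym : (X Y : String σ) → LCS X Y ≡ LCS Y X
  LCS-sym X Y = ≤-antisym (LCS-mono {X} {Y} {Y} {X} λ a b → _ , b , a , ≤-refl)
                          (LCS-mono {Y} {X} {X} {Y} λ a b → _ , b , a , ≤-refl)

  LCS-reverse : (X Y : String σ) → LCS (reverse X) (reverse Y) ≡ LCS X Y
  LCS-reverse X Y = ≤-antisym
    (LCS-mono {reverse X} {X} {reverse Y} {Y} λ {Z} a b → reverse Z ,
      subst (reverse Z ⊆_) (List.reverse-involutive X) (Sublist.reverse⁺ a) ,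
      subst (reverse Z ⊆_) (List.reverse-involutive Y) (Sublist.reverse⁺ b) ,
      ≤-reflexive (sym (List.length-reverse Z)))
    (LCS-mono {X} {reverse X} {Y} {reverse Y} λ {Z} a b → reverse Z ,
      Sublist.reverse⁺ a , Sublist.reverse⁺ b , ≤-reflexive (sym (List.length-reverse Z)))

  LCS-[]ˡ : (Y : String σ) → LCS [] Y ≡ 0
  LCS-[]ˡ Y = n≤0⇒n≡0 (subst (_≤ 0) (LCS-sym Y []) (LCS≤length Y []))

  LCS-[]ʳ : (X : String σ) → LCS X [] ≡ 0
  LCS-[]ʳ X = n≤0⇒n≡0 (LCS≤length X [])

  -- Dropping the first character of a common subsequence leaves a common subsequence of the tails,
  -- whether or not that character was matched with the heads; hence no case distinction on the
  -- embeddings.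
  LCS-∷-≡ : ∀ x (X Y : String σ) → LCS (x ∷ X) (x ∷ Y) ≡ suc (LCS X Y)
  LCS-∷-≡ x X Y = ≤-antisym upper lower
    where
    lower : suc (LCS X Y) ≤ LCS (x ∷ X) (x ∷ Y)
    lower with LCS-attained X Y
    ... | Z , a , b , eq = subst (λ k → suc k ≤ LCS (x ∷ X) (x ∷ Y)) eq
            (LCS-upper (refl ∷ a) (refl ∷ b))
    upper : LCS (x ∷ X) (x ∷ Y) ≤ suc (LCS X Y)
    upper with LCS-attained (x ∷ X) (x ∷ Y)
    ... | []    , _ , _ , eq = subst (_≤ suc (LCS X Y)) eq z≤n
    ... | z ∷ Z , a , b , eq = subst (_≤ suc (LCS X Y)) eq (s≤s (LCS-upper (Sublist.∷⁻ a) (Sublist.∷⁻ b)))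

  LCS-∷-≢ : ∀ {x y} (X Y : String σ) → x ≢ y →
            LCS (x ∷ X) (y ∷ Y) ≡ LCS (x ∷ X) Y ⊔ LCS X (y ∷ Y)
  LCS-∷-≢ {x} {y} X Y x≢y = ≤-antisym upper (⊔-lub
      (LCS-mono {x ∷ X} {x ∷ X} {Y} λ a b → _ , a , y Sublist.∷ʳ b , ≤-refl)
      (LCS-mono {X} {x ∷ X} {y ∷ Y} {y ∷ Y} λ a b → _ , x Sublist.∷ʳ a , b , ≤-refl))
    where
    upper : LCS (x ∷ X) (y ∷ Y) ≤ LCS (x ∷ X) Y ⊔ LCS X (y ∷ Y)
    upper with LCS-attained (x ∷ X) (y ∷ Y)
    ... | Z , a Sublist.∷ʳ p , q , eq = subst (_≤ LCS (x ∷ X) Y ⊔ LCS X (y ∷ Y)) eq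
            (≤-trans (LCS-upper p q) (m≤n⊔m (LCS (x ∷ X) Y) _))
    ... | Z , p@(_ ∷ _) , b Sublist.∷ʳ q , eq = subst (_≤ LCS (x ∷ X) Y ⊔ LCS X (y ∷ Y)) eq
            (≤-trans (LCS-upper p q) (m≤m⊔n _ (LCS X (y ∷ Y))))
    ... | z ∷ Z , refl ∷ p , refl ∷ q , eq = ⊥-elim (x≢y refl)

  -- Combing extends `A` and the substrings of `B` on the right, whereas lists grow on the left;
  -- double reversal transfers the recurrences from `_∷_` to `_∷ʳ_`.
  snoc≡reverse : ∀ (X : String σ) x → X ∷ʳ x ≡ reverse (x ∷ reverse X)
  snoc≡reverse X x = sym (trans (List.unfold-reverse x (reverse X))
                                (cong (_∷ʳ x) (List.reverse-involutive X)))

  LCS-∷ʳ-≡ : ∀ x (X Y : String σ) → LCS (X ∷ʳ x) (Y ∷ʳ x) ≡ suc (LCS X Y)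
  LCS-∷ʳ-≡ x X Y rewrite snoc≡reverse X x | snoc≡reverse Y x =
    trans (LCS-reverse (x ∷ reverse X) (x ∷ reverse Y))
      (trans (LCS-∷-≡ x (reverse X) (reverse Y)) (cong suc (LCS-reverse X Y)))

  LCS-∷ʳ-≢ : ∀ {x y} (X Y : String σ) → x ≢ y →
             LCS (X ∷ʳ x) (Y ∷ʳ y) ≡ LCS (X ∷ʳ x) Y ⊔ LCS X (Y ∷ʳ y)
  LCS-∷ʳ-≢ {x} {y} X Y x≢y = begin
    LCS (X ∷ʳ x) (Y ∷ʳ y)
      ≡⟨ cong₂ LCS (snoc≡reverse X x) (snoc≡reverse Y y) ⟩
    LCS (reverse (x ∷ reverse X)) (reverse (y ∷ reverse Y))
      ≡⟨ LCS-reverse (x ∷ reverse X) (y ∷ reverse Y) ⟩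
    LCS (x ∷ reverse X) (y ∷ reverse Y)
      ≡⟨ LCS-∷-≢ (reverse X) (reverse Y) x≢y ⟩
    LCS (x ∷ reverse X) (reverse Y) ⊔ LCS (reverse X) (y ∷ reverse Y)
      ≡⟨ cong₂ _⊔_ (sym (LCS-reverse (x ∷ reverse X) (reverse Y)))
                   (sym (LCS-reverse (reverse X) (y ∷ reverse Y))) ⟩
    LCS (reverse (x ∷ reverse X)) (reverse (reverse Y)) ⊔ LCS (reverse (reverse X)) (reverse (y ∷ reverse Y))
      ≡⟨ cong₂ _⊔_ (cong₂ LCS (sym (snoc≡reverse X x)) (List.reverse-involutive Y))
                   (cong₂ LCS (List.reverse-involutive X) (sym (snoc≡reverse Y y))) ⟩
    LCS (X ∷ʳ x) Y ⊔ LCS X (Y ∷ʳ y) ∎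
    where open ≡-Reasoning

  -- Positions count from 0 here, so charAt B j is the character of column j + 1; beyond the end it is 0.
  charAt : String σ → ℕ → ℕ
  charAt []      _       = 0
  charAt (b ∷ B) zero    = toℕ b
  charAt (b ∷ B) (suc j) = charAt B j

  charAt< : ∀ B j → charAt B j < suc σ
  charAt< []      j       = z<s
  charAt< (b ∷ B) zero    = m≤n⇒m≤1+n (Fin.toℕ<n b)
  charAt< (b ∷ B) (suc j) = charAt< B j

  substring-snoc : ∀ (B : String σ) {i j} → i ≤ j → j < length B →
                   ∃ λ b → B [ i ⋯ suc j ] ≡ B [ i ⋯ j ] ∷ʳ b × toℕ b ≡ charAt B j
  substring-snoc (b ∷ B) {zero}  {zero}  _ _ = b , refl , refl
  substring-snoc (b ∷ B) {zero}  {suc j} _ (s≤s j<) with substring-snoc B {zero} {j} z≤n j<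
  ... | c , eq , at = c , cong (b ∷_) eq , at
  substring-snoc (b ∷ B) {suc i} {suc j} (s≤s i≤j) (s≤s j<) = substring-snoc B i≤j j<

  substring-empty : ∀ (B : String σ) i → B [ i ⋯ i ] ≡ []
  substring-empty B i rewrite n∸n≡0 i = refl

  substring-all : ∀ (B : String σ) → B [ 0 ⋯ length B ] ≡ B
  substring-all B = List.take-all (length B) B ≤-refl

  substring-++ : ∀ (P M Q : String σ) → (P ++ M ++ Q) [ length P ⋯ length P + length M ] ≡ M
  substring-++ (_ ∷ P) M Q = substring-++ P M Q
  substring-++ []      []      Q = refl
  substring-++ []      (x ∷ M) Q = cong (x ∷_) (substring-++ [] M Q)

  -- Cut `B` into the parts `P` before, `M` inside and `Q` after the substring; the reversed indices
  -- are then the lengths of `reverse Q` and of `reverse Q ++ reverse M`.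
  substring-reverse : ∀ (B : String σ) {i j} → i ≤ j → j ≤ length B →
    reverse B [ length B ∸ j ⋯ length B ∸ i ] ≡ reverse (B [ i ⋯ j ])
  substring-reverse B {i} {j} i≤j j≤n = begin
    reverse B [ length B ∸ j ⋯ length B ∸ i ]
      ≡⟨ cong (_[ length B ∸ j ⋯ length B ∸ i ]) revB ⟩
    (reverse Q ++ reverse M ++ reverse P) [ length B ∸ j ⋯ length B ∸ i ]
      ≡⟨ cong₂ (λ k l → (reverse Q ++ reverse M ++ reverse P) [ k ⋯ l ]) left right ⟩
    (reverse Q ++ reverse M ++ reverse P) [ length (reverse Q) ⋯ length (reverse Q) + length (reverse M) ]
      ≡⟨ substring-++ (reverse Q) (reverse M) (reverse P) ⟩
    reverse M ∎
    where
    open ≡-Reasoning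
    P = List.take i B
    M = B [ i ⋯ j ]
    Q = List.drop (j ∸ i) (List.drop i B)
    revB : reverse B ≡ reverse Q ++ reverse M ++ reverse P
    revB = begin
      reverse B                                  ≡⟨ cong reverse (List.take++drop≡id i B) ⟨
      reverse (P ++ List.drop i B)                    ≡⟨ List.reverse-++ P (List.drop i B) ⟩
      reverse (List.drop i B) ++ reverse P            ≡⟨ cong (λ D → reverse D ++ reverse P) (List.take++drop≡id (j ∸ i) _) ⟨
      reverse (M ++ Q) ++ reverse P              ≡⟨ cong (_++ reverse P) (List.reverse-++ M Q) ⟩
      (reverse Q ++ reverse M) ++ reverse P      ≡⟨ List.++-assoc (reverse Q) (reverse M) (reverse P) ⟩
      reverse Q ++ reverse M ++ reverse P        ∎
    lenQ : length Q ≡ length B ∸ j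
    lenQ = begin
      length Q                      ≡⟨ List.length-drop (j ∸ i) (List.drop i B) ⟩
      length (List.drop i B) ∸ (j ∸ i)   ≡⟨ cong (_∸ (j ∸ i)) (List.length-drop i B) ⟩
      length B ∸ i ∸ (j ∸ i)        ≡⟨ ∸-+-assoc (length B) i (j ∸ i) ⟩
      length B ∸ (i + (j ∸ i))      ≡⟨ cong (length B ∸_) (m+[n∸m]≡n i≤j) ⟩
      length B ∸ j                  ∎
    lenM : length M ≡ j ∸ i
    lenM = begin
      length M                         ≡⟨ List.length-take (j ∸ i) (List.drop i B) ⟩
      (j ∸ i) ⊓ length (List.drop i B)      ≡⟨ cong ((j ∸ i) ⊓_) (List.length-drop i B) ⟩
      (j ∸ i) ⊓ (length B ∸ i)         ≡⟨ m≤n⇒m⊓n≡m (∸-monoˡ-≤ i j≤n) ⟩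
      j ∸ i                            ∎
    left : length B ∸ j ≡ length (reverse Q)
    left = sym (trans (List.length-reverse Q) lenQ)
    right : length B ∸ i ≡ length (reverse Q) + length (reverse M)
    right = sym (begin
      length (reverse Q) + length (reverse M)
        ≡⟨ cong₂ _+_ (trans (List.length-reverse Q) lenQ) (trans (List.length-reverse M) lenM) ⟩
      (length B ∸ j) + (j ∸ i)                ≡⟨ +-∸-assoc (length B ∸ j) i≤j ⟨
      (length B ∸ j) + j ∸ i                  ≡⟨ cong (_∸ i) (m∸n+n≡m j≤n) ⟩
      length B ∸ i                            ∎)

-- Combing

true-<ᵇ : ∀ {m n} → m < n → (m <ᵇ n) ≡ true
true-<ᵇ m<n = Equivalence.to T-≡ (<⇒<ᵇ m<n)

false-<ᵇ : ∀ {m n} → n ≤ m → (m <ᵇ n) ≡ false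
false-<ᵇ {m} {n} n≤m with m <ᵇ n in eq
... | false = refl
... | true  = ⊥-elim (<⇒≱ (<ᵇ⇒< m n (Equivalence.from T-≡ eq)) n≤m)

<ᵇ-true : ∀ {m n} → (m <ᵇ n) ≡ true → m < n
<ᵇ-true {m} {n} eq = <ᵇ⇒< m n (Equivalence.from T-≡ eq)

<ᵇ-false : ∀ {m n} → (m <ᵇ n) ≡ false → n ≤ m
<ᵇ-false eq = ≮⇒≥ λ m<n → case (trans (sym eq) (true-<ᵇ m<n))
  where
  case : false ≢ true
  case ()

true-≡ᵇ : ∀ n → (n ≡ᵇ n) ≡ true
true-≡ᵇ n = Equivalence.to T-≡ (≡⇒≡ᵇ n n refl)

false-≡ᵇ : ∀ {m n} → m ≢ n → (m ≡ᵇ n) ≡ false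
false-≡ᵇ {m} {n} m≢n with m ≡ᵇ n in eq
... | false = refl
... | true  = ⊥-elim (m≢n (≡ᵇ⇒≡ m n (Equivalence.from T-≡ eq)))

-- The indicator of i < v as a number, so that counting identities can be rearranged and cancelled.
-- Here i is a boundary between rows and v a row counted from 1; the value 0, for no pivotal point,
-- contributes nothing at any i.
above : ℕ → ℕ → ℕ
above i v = if i <ᵇ v then 1 else 0

above-< : ∀ {i v} → i < v → above i v ≡ 1
above-< i<v rewrite true-<ᵇ i<v = refl

above-≥ : ∀ {i v} → v ≤ i → above i v ≡ 0
above-≥ v≤i rewrite false-<ᵇ v≤i = refl

above-≡1 : ∀ {i v} → above i v ≡ 1 → i < v
above-≡1 {i} {v} eq with i <? v
... | yes i<v = i<v
... | no i≮v with trans (sym eq) (above-≥ (≮⇒≥ i≮v))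
...   | ()

above-≡0 : ∀ {i v} → above i v ≡ 0 → v ≤ i
above-≡0 {i} {v} eq = ≮⇒≥ λ i<v → case (trans (sym eq) (above-< i<v))
  where
  case : 0 ≢ 1
  case ()

above≤1 : ∀ i v → above i v ≤ 1
above≤1 i v with i <ᵇ v
... | true  = ≤-refl
... | false = z≤n

above-⊓ : ∀ i v h → above i (if v <ᵇ h then v else h) ≡ above i v * above i h
above-⊓ i v h with v <? h
... | yes v<h rewrite true-<ᵇ v<h with i <? v
...   | yes i<v rewrite above-< i<v | above-< (<-trans i<v v<h) = refl
...   | no i≮v rewrite above-≥ (≮⇒≥ i≮v) = refl
above-⊓ i v h | no v≮h rewrite false-<ᵇ (≮⇒≥ v≮h) with i <? h
...   | yes i<h rewrite above-< i<h | above-< (<-≤-trans i<h (≮⇒≥ v≮h)) = refl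
...   | no i≮h rewrite above-≥ (≮⇒≥ i≮h) = sym (*-zeroʳ (above i v))

count : (ℕ → ℕ) → ℕ → ℕ → ℕ
count p i zero    = 0
count p i (suc j) = count p i j + above i (p (suc j))

-- Each b in the range satisfies p b ≤ b ≤ j ≤ i. This makes j - i minus the count valid in the
-- lower triangle of `𝒦` as well.
count-triangular : ∀ {p} → (∀ j → p j ≤ j) → ∀ {i} j → j ≤ i → count p i j ≡ 0
count-triangular b zero    _ = refl
count-triangular b (suc j) j≤i rewrite above-≥ (≤-trans (b (suc j)) j≤i) =
  trans (+-identityʳ _) (count-triangular b j (<⇒≤ j≤i))

swaps : ℕ → ℕ → ℕ → ℕ → Bool
swaps x c v h = (c ≡ᵇ x) ∨ (v <ᵇ h)

module Comb (c : ℕ → ℕ) (x : ℕ) (p : ℕ → ℕ) where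

  hold : ℕ → ℕ
  hold zero    = 0
  hold (suc j) = if swaps x (c j) (p (suc j)) (hold j) then p (suc j) else hold j

  comb : ℕ → ℕ
  comb zero    = 0
  comb (suc j) = if swaps x (c j) (p (suc j)) (hold j) then hold j else p (suc j)

  -- Each column only permutes its own row and the held one, and the hand starts with 0, which
  -- counts for no i.
  comb-count : ∀ i j → count comb i j + above i (hold j) ≡ count p i j
  comb-count i zero    = refl
  comb-count i (suc j) with swaps x (c j) (p (suc j)) (hold j)
  ... | true  = cong (_+ above i (p (suc j))) (comb-count i j)
  ... | false = begin
    count comb i j + above i (p (suc j)) + above i (hold j) ≡⟨ +-assoc (count comb i j) _ _ ⟩
    count comb i j + (above i (p (suc j)) + above i (hold j)) ≡⟨ cong (count comb i j +_) (+-comm (above i (p (suc j))) _) ⟩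
    count comb i j + (above i (hold j) + above i (p (suc j))) ≡⟨ +-assoc (count comb i j) _ _ ⟨
    count comb i j + above i (hold j) + above i (p (suc j)) ≡⟨ cong (_+ above i (p (suc j))) (comb-count i j) ⟩
    count p i j + above i (p (suc j)) ∎
    where open ≡-Reasoning

  module _ (p-bounded : ∀ j → p j ≤ j) where

    hold≤ : ∀ j → hold j ≤ j
    hold≤ zero    = z≤n
    hold≤ (suc j) with swaps x (c j) (p (suc j)) (hold j)
    ... | true  = p-bounded (suc j)
    ... | false = m≤n⇒m≤1+n (hold≤ j)

    comb≤ : ∀ j → comb j ≤ j
    comb≤ zero    = z≤n
    comb≤ (suc j) with swaps x (c j) (p (suc j)) (hold j)
    ... | true  = m≤n⇒m≤1+n (hold≤ j)
    ... | false = p-bounded (suc j)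

open Comb using (hold; comb)

module _ {σ : ℕ} where

  -- p sends a column (counted from 1) to the row of its pivotal point, or to 0 if it has none.
  record Pivots (A B : String σ) (p : ℕ → ℕ) : Set where
    field
      bounded : ∀ j → p j ≤ j
      LCS-count : ∀ {i j} → i ≤ j → j ≤ length B → LCS (B [ i ⋯ j ]) A + count p i j + i ≡ j

  open Pivots public

  -- Between `LCS-count` at j and at j + 1 only the contribution of the new column remains.
  Pivots-unit : ∀ {A B : String σ} {p} (P : Pivots A B p) {i j} → i ≤ j → j < length B →
             LCS (B [ i ⋯ suc j ]) A + above i (p (suc j)) ≡ suc (LCS (B [ i ⋯ j ]) A)
  Pivots-unit {A} {B} {p} P {i} {j} i≤j j<n = +-cancelʳ-≡ (count p i j + i) _ _ (begin
    K₁ + a + (N + i)    ≡⟨ +-assoc (K₁ + a) N i ⟨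
    K₁ + a + N + i      ≡⟨ cong (_+ i) (+-assoc K₁ a N) ⟩
    K₁ + (a + N) + i    ≡⟨ cong (λ z → K₁ + z + i) (+-comm a N) ⟩
    K₁ + (N + a) + i    ≡⟨ LCS-count P (m≤n⇒m≤1+n i≤j) j<n ⟩
    suc j               ≡⟨ cong suc (LCS-count P i≤j (<⇒≤ j<n)) ⟨
    suc (K + N + i)     ≡⟨ cong suc (+-assoc K N i) ⟩
    suc K + (N + i)     ∎)
    where
    open ≡-Reasoning
    K₁ = LCS (B [ i ⋯ suc j ]) A
    K  = LCS (B [ i ⋯ j ]) A
    a  = above i (p (suc j))
    N  = count p i j

  private
    -- If i < v, then K₁ = K and the maximum gains what h contributes; otherwise K₁ = K + 1 already
    -- dominates. The product is the indicator for the minimum of v and h.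
    ⊔-step : ∀ {K K₁ v h} i → K₁ + above i v ≡ suc K →
             K₁ ⊔ (K + above i h) ≡ K₁ + above i v * above i h
    ⊔-step {K} {K₁} {v} {h} i eq with i <? v
    ... | yes i<v rewrite above-< i<v with suc-injective (trans (+-comm 1 K₁) eq)
    ...   | refl = trans (m≤n⇒m⊔n≡n (m≤m+n K (above i h))) (cong (K +_) (sym (*-identityˡ _)))
    ⊔-step {K} {K₁} {v} {h} i eq | no i≮v rewrite above-≥ (≮⇒≥ i≮v) =
      trans (m≥n⇒m⊔n≡m le) (sym (+-identityʳ K₁))
      where
      le : K + above i h ≤ K₁
      le = subst (K + above i h ≤_) (trans (+-comm K 1) (trans (sym eq) (+-identityʳ K₁)))
             (+-monoʳ-≤ K (above≤1 i h))

  module _ {A B : String σ} {p : ℕ → ℕ} (P : Pivots A B p) (x : Fin σ) where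

    private
      h = hold (charAt B) (toℕ x) p

    -- The origin of the exchange rule. On a match the new LCS is one more than the old one at j,
    -- which `Pivots-unit` rewrites as the old one at j + 1 plus `above i (p (suc j))`, so the hand
    -- goes on with that row. On a mismatch the maximum in the recurrence becomes the minimum of the
    -- two rows.
    LCS-hold-step : ∀ {i j} → i ≤ j → j < length B →
      LCS (B [ i ⋯ j ]) (A ∷ʳ x) ≡ LCS (B [ i ⋯ j ]) A + above i (h j) →
      LCS (B [ i ⋯ suc j ]) (A ∷ʳ x) ≡ LCS (B [ i ⋯ suc j ]) A + above i (h (suc j))
    LCS-hold-step {i} {j} i≤j j<n ih with substring-snoc B i≤j j<n | Pivots-unit P i≤j j<n
    ... | b , eq , at | unit rewrite eq with b Fin.≟ x
    ...   | yes refl rewrite sym at | true-≡ᵇ (toℕ b) = trans (LCS-∷ʳ-≡ b (B [ i ⋯ j ]) A) (sym unit)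
    ...   | no b≢x rewrite sym at | false-≡ᵇ (λ e → b≢x (Fin.toℕ-injective e)) = begin
      LCS (B [ i ⋯ j ] ∷ʳ b) (A ∷ʳ x)         ≡⟨ LCS-∷ʳ-≢ (B [ i ⋯ j ]) A b≢x ⟩
      K₁ ⊔ LCS (B [ i ⋯ j ]) (A ∷ʳ x)         ≡⟨ cong (K₁ ⊔_) ih ⟩
      K₁ ⊔ (LCS (B [ i ⋯ j ]) A + above i (h j)) ≡⟨ ⊔-step {v = p (suc j)} {h = h j} i unit ⟩
      K₁ + above i (p (suc j)) * above i (h j) ≡⟨ cong (K₁ +_) (above-⊓ i (p (suc j)) (h j)) ⟨
      K₁ + above i (if p (suc j) <ᵇ h j then p (suc j) else h j) ∎
      where
      open ≡-Reasoning
      K₁ = LCS (B [ i ⋯ j ] ∷ʳ b) A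

    -- One walk from column 0 serves all left ends i at once: at j = i, where the substring is
    -- empty, the hand holds a row at most i, which is as good as 0 for this i.
    LCS-hold : ∀ {i} j → i ≤ j → j ≤ length B →
               LCS (B [ i ⋯ j ]) (A ∷ʳ x) ≡ LCS (B [ i ⋯ j ]) A + above i (h j)
    LCS-hold {i} j i≤j j≤n with m≤n⇒m<n∨m≡n i≤j
    LCS-hold {i} (suc j) i≤j j≤n | inj₁ (s≤s i≤j′) = LCS-hold-step i≤j′ j≤n (LCS-hold j i≤j′ (<⇒≤ j≤n))
    LCS-hold {i} j i≤j j≤n | inj₂ refl
      rewrite substring-empty B i | LCS-[]ˡ (A ∷ʳ x) | LCS-[]ˡ A
      = sym (above-≥ (Comb.hold≤ (charAt B) (toℕ x) p (bounded P) i))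

    Pivots-comb : Pivots (A ∷ʳ x) B (comb (charAt B) (toℕ x) p)
    Pivots-comb .bounded = Comb.comb≤ (charAt B) (toℕ x) p (bounded P)
    Pivots-comb .LCS-count {i} {j} i≤j j≤n = begin
      LCS (B [ i ⋯ j ]) (A ∷ʳ x) + N′ + i ≡⟨ cong (λ z → z + N′ + i) (LCS-hold j i≤j j≤n) ⟩
      K + above i (h j) + N′ + i          ≡⟨ cong (_+ i) (+-assoc K (above i (h j)) N′) ⟩
      K + (above i (h j) + N′) + i        ≡⟨ cong (λ z → K + z + i) (+-comm (above i (h j)) N′) ⟩
      K + (N′ + above i (h j)) + i        ≡⟨ cong (λ z → K + z + i) (Comb.comb-count (charAt B) (toℕ x) p i j) ⟩
      K + count p i j + i                 ≡⟨ LCS-count P i≤j j≤n ⟩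
      j                                   ∎
      where
      open ≡-Reasoning
      K = LCS (B [ i ⋯ j ]) A
      N′ = count (comb (charAt B) (toℕ x) p) i j

  count-id : ∀ {i j} → i ≤ j → count (λ v → v) i j + i ≡ j
  count-id {i} {j} i≤j with m≤n⇒m<n∨m≡n i≤j
  count-id {i} {suc j} _ | inj₁ (s≤s i≤j) rewrite above-< (s≤s i≤j) =
    trans (cong (_+ i) (+-comm (count (λ v → v) i j) 1)) (cong suc (count-id i≤j))
  count-id {i} {j} _ | inj₂ refl = cong (_+ i) (count-triangular (λ _ → ≤-refl) i ≤-refl)

  Pivots-[] : ∀ B → Pivots [] B (λ j → j)
  Pivots-[] B .bounded j = ≤-refl
  Pivots-[] B .LCS-count {i} {j} i≤j _ rewrite LCS-[]ʳ (B [ i ⋯ j ]) = count-id i≤j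

  -- The instance i = 0, j = n of `LCS-count`; it bounds the lengths of the lists.
  Pivots-size : ∀ {A B : String σ} {p} → Pivots A B p → count p 0 (length B) ≡ Δ A B
  Pivots-size {A} {B} {p} P = begin
    N           ≡⟨ m+n∸m≡n K N ⟨
    K + N ∸ K   ≡⟨ cong (_∸ K) eq ⟩
    length B ∸ K ≡⟨ cong (length B ∸_) (trans (cong (λ S → LCS S A) (substring-all B)) (LCS-sym B A)) ⟩
    Δ A B       ∎
    where
    open ≡-Reasoning
    K = LCS (B [ 0 ⋯ length B ]) A
    N = count p 0 (length B)
    eq : K + N ≡ length B
    eq = trans (sym (+-identityʳ (K + N))) (LCS-count P z≤n ≤-refl)

  Δ-reverse : ∀ (A B : String σ) → Δ (reverse A) (reverse B) ≡ Δ A B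
  Δ-reverse A B = cong₂ _∸_ (List.length-reverse B) (LCS-reverse A B)

  -- Reversal

  module Mirror {A B : String σ} {p q : ℕ → ℕ}
                (P : Pivots A B p) (Q : Pivots (reverse A) (reverse B) q) where

    private
      n = length B

    -- Both counts are the length minus the LCS of one substring, read in the two directions; below
    -- the diagonal both vanish.
    mirror-count : ∀ {i j} → i ≤ n → j ≤ n → count q (n ∸ j) (n ∸ i) ≡ count p i j
    mirror-count {i} {j} i≤n j≤n with i ≤? j
    ... | no i≰j = trans (count-triangular (bounded Q) (n ∸ i) (∸-monoʳ-≤ n (≰⇒≥ i≰j)))
                         (sym (count-triangular (bounded P) j (≰⇒≥ i≰j)))
    ... | yes i≤j = +-cancelˡ-≡ K _ _ (+-cancelʳ-≡ i _ _ (+-cancelʳ-≡ n _ _ (begin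
      K + cq + i + n              ≡⟨ cong (λ z → K + cq + i + z) (m∸n+n≡m j≤n) ⟨
      K + cq + i + (n ∸ j + j)    ≡⟨ +-assoc (K + cq) i _ ⟩
      K + cq + (i + (n ∸ j + j))  ≡⟨ cong (K + cq +_) (+-comm i _) ⟩
      K + cq + (n ∸ j + j + i)    ≡⟨ cong (K + cq +_) (+-assoc (n ∸ j) j i) ⟩
      K + cq + (n ∸ j + (j + i))  ≡⟨ +-assoc (K + cq) (n ∸ j) (j + i) ⟨
      K + cq + (n ∸ j) + (j + i)  ≡⟨ cong (λ z → z + cq + (n ∸ j) + (j + i)) mirror-LCS ⟨
      K̄ + cq + (n ∸ j) + (j + i)  ≡⟨ cong (_+ (j + i)) (LCS-count Q (∸-monoʳ-≤ n i≤j) n∸i≤) ⟩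
      n ∸ i + (j + i)             ≡⟨ cong (n ∸ i +_) (+-comm j i) ⟩
      n ∸ i + (i + j)             ≡⟨ +-assoc (n ∸ i) i j ⟨
      n ∸ i + i + j               ≡⟨ cong (_+ j) (m∸n+n≡m i≤n) ⟩
      n + j                       ≡⟨ +-comm n j ⟩
      j + n                       ≡⟨ cong (_+ n) (LCS-count P i≤j j≤n) ⟨
      K + count p i j + i + n     ∎)))
      where
      open ≡-Reasoning
      K = LCS (B [ i ⋯ j ]) A
      K̄ = LCS (reverse B [ n ∸ j ⋯ n ∸ i ]) (reverse A)
      cq = count q (n ∸ j) (n ∸ i)
      mirror-LCS : K̄ ≡ K
      mirror-LCS = trans (cong (λ S → LCS S (reverse A)) (substring-reverse B i≤j j≤n))
                         (LCS-reverse (B [ i ⋯ j ]) A)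
      n∸i≤ : n ∸ i ≤ length (reverse B)
      n∸i≤ = subst (n ∸ i ≤_) (sym (List.length-reverse B)) (m∸n≤m n i)

    private
      pred-∸ : ∀ {a} → a < n → n ∸ a ≡ suc (n ∸ suc a)
      pred-∸ a<n = +-∸-assoc 1 a<n

    -- A pivotal point shows in the counts at the four corners of its cell, and `mirror-count`
    -- carries these over. Counted from 1, row a + 1 and column b + 1 become row n - b and column n
    -- - a.
    mirror-suc : ∀ {a b} → b < n → p (suc b) ≡ suc a → q (n ∸ a) ≡ n ∸ b
    mirror-suc {a} {b} b<n eq = trans (trans (cong q (pred-∸ a<n)) (≤-antisym q≤ q≥)) (sym (pred-∸ b<n))
      where
      open ≡-Reasoning
      a<n : a < n
      a<n = ≤-trans (subst (_≤ suc b) eq (bounded P (suc b))) b<n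
      v = q (suc (n ∸ suc a))
      b̄ = n ∸ suc b
      -- Inclusion–exclusion on the four corners of the cell, read in both orientations.
      corners : suc (above (suc b̄) v) ≡ above b̄ v
      corners = +-cancelˡ-≡ (count p (suc a) b) _ _ (begin
        Y + suc (above (suc b̄) v)   ≡⟨ +-suc Y _ ⟩
        suc (Y + above (suc b̄) v)
          ≡⟨ cong (λ z → suc (z + above (suc b̄) v))
               (trans (sym (mirror-count a<n (<⇒≤ b<n))) (cong (λ z → count q z (n ∸ suc a)) (pred-∸ b<n))) ⟩
        suc (count q (suc b̄) (suc (n ∸ suc a)))
          ≡⟨ cong suc (cong₂ (count q) (pred-∸ b<n) (pred-∸ a<n)) ⟨
        suc (count q (n ∸ b) (n ∸ a)) ≡⟨ cong suc (mirror-count (<⇒≤ a<n) (<⇒≤ b<n)) ⟩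
        suc (count p a b)           ≡⟨ +-comm 1 _ ⟩
        count p a b + 1             ≡⟨ cong (count p a b +_) (sym (above-< (≤-reflexive (sym eq)))) ⟩
        count p a (suc b)           ≡⟨ mirror-count (<⇒≤ a<n) b<n ⟨
        count q b̄ (n ∸ a)           ≡⟨ cong (count q b̄) (pred-∸ a<n) ⟩
        count q b̄ (n ∸ suc a) + above b̄ v ≡⟨ cong (_+ above b̄ v) (mirror-count a<n b<n) ⟩
        count p (suc a) (suc b) + above b̄ v
          ≡⟨ cong (λ z → Y + z + above b̄ v) (above-≥ (≤-reflexive eq)) ⟩
        Y + 0 + above b̄ v           ≡⟨ cong (_+ above b̄ v) (+-identityʳ Y) ⟩
        Y + above b̄ v               ∎)
        where Y = count p (suc a) b
      -- Both indicators are at most 1, so `corners` forces them to be 0 and 1, which leaves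
      -- `suc b̄` as the only value of `v`.
      q≥ : suc b̄ ≤ v
      q≥ = above-≡1 (≤-antisym (above≤1 b̄ v) (subst (1 ≤_) corners (s≤s z≤n)))
      q≤ : v ≤ suc b̄
      q≤ = above-≡0 (n≤0⇒n≡0 (s≤s⁻¹ (subst (_≤ 1) (sym corners) (above≤1 b̄ v))))

    mirror : ∀ {j} → 0 < j → j ≤ n → 0 < p j → q (suc n ∸ p j) ≡ suc n ∸ j
    mirror {suc b} _ b<n 0<p with p (suc b) in eq
    mirror {suc b} _ b<n ()  | zero
    mirror {suc b} _ b<n 0<p | suc a = mirror-suc b<n eq

    -- Lowering i from a + 1 to a adds the pivotal points of row a + 1; mirrored, this is the single
    -- column n - a of `q`. Hence `p` uses row a + 1 exactly if that column is nonzero.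
    occupied : ∀ {a} → a < n → count p (suc a) n + above 0 (q (n ∸ a)) ≡ count p a n
    occupied {a} a<n = begin
      count p (suc a) n + above 0 (q (n ∸ a))
        ≡⟨ cong (_+ above 0 (q (n ∸ a))) (trans (sym (mirror-count a<n ≤-refl))
                                              (cong (λ z → count q z (n ∸ suc a)) (n∸n≡0 n))) ⟩
      count q 0 (n ∸ suc a) + above 0 (q (n ∸ a))
        ≡⟨ cong (λ z → count q 0 (n ∸ suc a) + above 0 (q z)) (pred-∸ a<n) ⟩
      count q 0 (suc (n ∸ suc a))  ≡⟨ cong₂ (count q) (n∸n≡0 n) (pred-∸ a<n) ⟨
      count q (n ∸ n) (n ∸ a)      ≡⟨ mirror-count (<⇒≤ a<n) ≤-refl ⟩
      count p a n                  ∎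
      where open ≡-Reasoning

  open Mirror public using (mirror)

  -- Only the row that the hand still holds at the end disappears.
  module Exit {A B : String σ} {p q q′ : ℕ → ℕ} (x : Fin σ)
              (P : Pivots A B p) (Q : Pivots (reverse A) (reverse B) q)
              (Q′ : Pivots (reverse (A ∷ʳ x)) (reverse B) q′) where

    private
      n = length B
      H = hold (charAt B) (toℕ x) p n
      p′ = comb (charAt B) (toℕ x) p

    -- `occupied` before and after the update, connected by `comb-count` at a and at a + 1. The two
    -- indicators of `H` differ only for H = a + 1, so the supports of `q` and `q′` differ only in
    -- the column that mirrors `H`.
    exit-balance : ∀ {a} → a < n → above 0 (q′ (n ∸ a)) + above a H ≡ above (suc a) H + above 0 (q (n ∸ a))
    exit-balance {a} a<n = +-cancelˡ-≡ (count p′ (suc a) n) _ _ (begin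
      N + (u′ + above a H)      ≡⟨ +-assoc N u′ (above a H) ⟨
      N + u′ + above a H        ≡⟨ cong (_+ above a H) (Mirror.occupied (Pivots-comb P x) Q′ a<n) ⟩
      count p′ a n + above a H  ≡⟨ Comb.comb-count (charAt B) (toℕ x) p a n ⟩
      count p a n               ≡⟨ Mirror.occupied P Q a<n ⟨
      count p (suc a) n + u     ≡⟨ cong (_+ u) (Comb.comb-count (charAt B) (toℕ x) p (suc a) n) ⟨
      N + above (suc a) H + u   ≡⟨ +-assoc N (above (suc a) H) u ⟩
      N + (above (suc a) H + u) ∎)
      where
      open ≡-Reasoning
      N = count p′ (suc a) n
      u = above 0 (q (n ∸ a))
      u′ = above 0 (q′ (n ∸ a))

    private
      exit-suc : ∀ {a} → a < n → H ≡ suc a → q′ (n ∸ a) ≡ 0 × 0 < q (n ∸ a)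
      exit-suc {a} a<n eq with exit-balance a<n
      ... | bal rewrite above-< (≤-reflexive (sym eq)) | above-≥ (≤-reflexive eq) =
        n≤0⇒n≡0 (above-≡0 (n≤0⇒n≡0 (s≤s⁻¹ (subst (_≤ 1) (trans (sym bal) (+-comm _ 1)) (above≤1 0 (q (n ∸ a))))))) ,
        above-≡1 (≤-antisym (above≤1 0 (q (n ∸ a))) (subst (1 ≤_) bal (m≤n+m 1 _)))

      stay-suc : ∀ {a} → a < n → H ≢ suc a → above 0 (q′ (n ∸ a)) ≡ above 0 (q (n ∸ a))
      stay-suc {a} a<n H≢ with exit-balance a<n | a <? H
      ... | bal | yes a<H rewrite above-< a<H | above-< (≤∧≢⇒< a<H (λ e → H≢ (sym e))) =
        suc-injective (trans (+-comm 1 _) bal)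
      ... | bal | no a≮H rewrite above-≥ (≮⇒≥ a≮H) | above-≥ (m≤n⇒m≤1+n (≮⇒≥ a≮H)) =
        trans (sym (+-identityʳ _)) bal

    exit : ∀ {k} → 0 < k → k ≤ n → k ≡ suc n ∸ H → q′ k ≡ 0 × 0 < q k
    exit {suc k} _ k<n eq = subst (λ z → q′ z ≡ 0 × 0 < q z) (m∸[m∸n]≡n k<n)
        (exit-suc (∸-monoʳ-< {o = 0} z<s k<n) H≡)
      where
      H≤n : H ≤ suc n
      H≤n = m≤n⇒m≤1+n (Comb.hold≤ (charAt B) (toℕ x) p (bounded P) n)
      H≡ : H ≡ suc (n ∸ suc k)
      H≡ = trans (sym (m∸[m∸n]≡n H≤n)) (trans (cong (suc n ∸_) (sym eq)) (+-∸-assoc 1 k<n))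

    stay : ∀ {k} → 0 < k → k ≤ n → k ≢ suc n ∸ H → above 0 (q′ k) ≡ above 0 (q k)
    stay {suc k} _ k<n neq = subst (λ z → above 0 (q′ z) ≡ above 0 (q z)) (m∸[m∸n]≡n k<n)
        (stay-suc (∸-monoʳ-< {o = 0} z<s k<n) λ H≡ →
          neq (sym (trans (cong (suc n ∸_) H≡) (m∸[m∸n]≡n k<n))))

-- The pivotal points of `𝒦`

module _ {σ : ℕ} {A B : String σ} {p : ℕ → ℕ} (P : Pivots A B p) where

  private
    n = length B

  𝒦-count : ∀ i j → 𝒦 A B i j ≡ ⁺ toℕ j -ᶻ ⁺ toℕ i -ᶻ ⁺ count p (toℕ i) (toℕ j)
  𝒦-count i j with i Fin.≤? j
  ... | no i≰j rewrite dec-false (i Fin.≤? j) i≰j | count-triangular (bounded P) {toℕ i} (toℕ j) (≰⇒≥ i≰j) =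
    sym (ℤ.+-identityʳ _)
  ... | yes i≤j rewrite dec-true (i Fin.≤? j) i≤j = begin
    ⁺ K                                   ≡⟨ solve 3 (λ k c i → k := (k :+ c :+ i) :- i :- c) refl (⁺ K) (⁺ c) (⁺ toℕ i) ⟩
    ⁺ (K + c + toℕ i) -ᶻ ⁺ toℕ i -ᶻ ⁺ c ≡⟨ cong (λ z → ⁺ z -ᶻ ⁺ toℕ i -ᶻ ⁺ c) (LCS-count P i≤j (s≤s⁻¹ (Fin.toℕ<n j))) ⟩
    ⁺ toℕ j -ᶻ ⁺ toℕ i -ᶻ ⁺ c             ∎
    where
    open ≡-Reasoning
    open ℤ.+-*-Solver
    K = LCS (B [ toℕ i ⋯ toℕ j ]) A
    c = count p (toℕ i) (toℕ j)

  -- The linear part j - i has mixed difference zero. In the count, the difference in j isolates one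
  -- column, and the difference in i then tests whether its row is the given one.
  density-𝒦 : ∀ i j → density (𝒦 A B) i j ≡
    ⁺ above (toℕ i) (p (suc (toℕ j))) -ᶻ ⁺ above (suc (toℕ i)) (p (suc (toℕ j)))
  density-𝒦 i j
    rewrite 𝒦-count (Fin.suc i) (Fin.suc j) | 𝒦-count (inject₁ i) (inject₁ j)
          | 𝒦-count (inject₁ i) (Fin.suc j) | 𝒦-count (Fin.suc i) (inject₁ j)
          | Fin.toℕ-inject₁ i | Fin.toℕ-inject₁ j
    = solve 8 (λ j i j₁ i₁ c₁₁ c₀₀ u v →
        (((j₁ :- i₁ :- (c₁₁ :+ v)) :+ (j :- i :- c₀₀)) :- (j₁ :- i :- (c₀₀ :+ u))) :- (j :- i₁ :- c₁₁) := u :- v) refl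
      (⁺ toℕ j) (⁺ toℕ i) (⁺ suc (toℕ j)) (⁺ suc (toℕ i))
      (⁺ count p (suc (toℕ i)) (toℕ j)) (⁺ count p (toℕ i) (toℕ j))
      (⁺ above (toℕ i) (p (suc (toℕ j)))) (⁺ above (suc (toℕ i)) (p (suc (toℕ j))))
    where open ℤ.+-*-Solver

  pivotal⇔ : ∀ i j → Pivotal (𝒦 A B) (i , j) ⇔ (p (suc (toℕ j)) ≡ suc (toℕ i))
  pivotal⇔ i j = mk⇔ to from
    where
    v = p (suc (toℕ j))
    to : Pivotal (𝒦 A B) (i , j) → v ≡ suc (toℕ i)
    to piv with v ≟ suc (toℕ i) | toℕ i <? v
    ... | yes eq | _ = eq
    ... | no v≢ | yes i<v = ⊥-elim (piv (trans (density-𝒦 i j)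
            (cong₂ (λ a b → ⁺ a -ᶻ ⁺ b) (above-< i<v) (above-< (≤∧≢⇒< i<v (λ e → v≢ (sym e)))))))
    ... | no v≢ | no i≮v = ⊥-elim (piv (trans (density-𝒦 i j)
            (cong₂ (λ a b → ⁺ a -ᶻ ⁺ b) (above-≥ (≮⇒≥ i≮v)) (above-≥ (m≤n⇒m≤1+n (≮⇒≥ i≮v))))))
    from : v ≡ suc (toℕ i) → Pivotal (𝒦 A B) (i , j)
    from eq zero-density with trans (sym zero-density) (trans (density-𝒦 i j)
            (cong₂ (λ a b → ⁺ a -ᶻ ⁺ b) (above-< (≤-reflexive (sym eq))) (above-≥ (≤-reflexive eq))))
    ... | ()

-- Reasoning about the machine

module Machine (S W : ℕ) {k : ℕ} where

  Exec : Cmd k → State k → ℕ → (State k → Set) → Set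
  Exec c s T Q = ∃ λ t → ∃ λ s′ → Run S W c s t s′ × t ≤ T × Q s′

  exec-map : ∀ {c s T T′ Q Q′} → T ≤ T′ → (∀ s′ → Q s′ → Q′ s′) → Exec c s T Q → Exec c s T′ Q′
  exec-map T≤T′ f (t , s′ , r , t≤T , q) = t , s′ , r , ≤-trans t≤T T≤T′ , f s′ q

  exec-⨾ : ∀ {c d s T T′ Q R} → Exec c s T Q → (∀ s′ → Q s′ → Exec d s′ T′ R) → Exec (c ⨾ d) s (T + T′) R
  exec-⨾ (_ , s′ , r , t≤ , q) f with f s′ q
  ... | _ , s″ , r′ , t′≤ , q′ = _ , s″ , run-⨾ r r′ , +-mono-≤ t≤ t′≤ , q′

  exec-done : ∀ {b c d s T R} → ⟦ b ⟧ₜ s ≡ false → Exec d s T R → Exec (while b c ⨾ d) s (suc T) R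
  exec-done b≡ (_ , s′ , r , t≤ , q) = _ , s′ , run-⨾ (run-done b≡) r , s≤s t≤ , q

  -- A loop is always treated together with the command that follows it: an induction over the
  -- iterations ends by running that command, and no separate assertion for the loop exit has to be
  -- stated.
  exec-again : ∀ {b c d s T T′ Q R} → ⟦ b ⟧ₜ s ≡ true → Exec c s T Q →
               (∀ s′ → Q s′ → Exec (while b c ⨾ d) s′ T′ R) → Exec (while b c ⨾ d) s (suc (T + T′)) R
  exec-again b≡ (t , s′ , r , t≤ , q) f with f s′ q
  ... | _ , s″ , run-⨾ {t = t₁} {t′ = t₂} r₁ r₂ , t′≤ , q′ =
    _ , s″ , run-⨾ (run-again b≡ r r₁) r₂ ,
    s≤s (≤-trans (≤-reflexive (+-assoc t t₁ t₂)) (+-mono-≤ t≤ t′≤)) , q′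

  exec-if : ∀ {b c d s T Q} → (⟦ b ⟧ₜ s ≡ true → Exec c s T Q) → (⟦ b ⟧ₜ s ≡ false → Exec d s T Q) →
            Exec (ifelse b c d) s (suc T) Q
  exec-if {b} {s = s} f g with ⟦ b ⟧ₜ s in eq
  ... | true with f refl
  ...   | _ , s′ , r , t≤ , q = _ , s′ , run-then eq r , s≤s t≤ , q
  exec-if {b} {s = s} f g | false with g refl
  ...   | _ , s′ , r , t≤ , q = _ , s′ , run-else eq r , s≤s t≤ , q

  -- Weakest preconditions of loop-free commands.
  WP : Cmd k → State k → (State k → Set) → Set
  WP skip           s Q = Q s
  WP (x ≔ e)        s Q = ⟦ e ⟧ₑ s < W × Q (setReg x (⟦ e ⟧ₑ s) s)
  WP (load x a)     s Q = ⟦ a ⟧ₒ s < S × Q (setReg x (mem s (⟦ a ⟧ₒ s)) s)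
  WP (store a v)    s Q = ⟦ a ⟧ₒ s < S × ⟦ v ⟧ₒ s < W × Q (setMem (⟦ a ⟧ₒ s) (⟦ v ⟧ₒ s) s)
  WP (c ⨾ d)        s Q = WP c s λ s′ → WP d s′ Q
  WP (ifelse b c d) s Q = (⟦ b ⟧ₜ s ≡ true → WP c s Q) × (⟦ b ⟧ₜ s ≡ false → WP d s Q)
  WP (while _ _)    s Q = ⊥

  size : Cmd k → ℕ
  size (c ⨾ d)        = size c + size d
  size (ifelse _ c d) = suc (size c + size d)
  size _              = 1

  exec : ∀ c {s Q} → WP c s Q → Exec c s (size c) Q
  exec skip           q             = _ , _ , run-skip , ≤-refl , q
  exec (x ≔ e)        (e< , q)      = _ , _ , run-≔ e< , ≤-refl , q
  exec (load x a)     (a< , q)      = _ , _ , run-load a< , ≤-refl , q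
  exec (store a v)    (a< , v< , q) = _ , _ , run-store a< v< , ≤-refl , q
  exec (c ⨾ d)        q             = exec-⨾ (exec c q) λ _ → exec d
  exec (ifelse b c d) (f , g)       = exec-if
    (λ e → exec-map (m≤m+n (size c) (size d)) (λ _ q → q) (exec c (f e)))
    (λ e → exec-map (m≤n+m (size d) (size c)) (λ _ q → q) (exec d (g e)))

  -- A syntactic check, so that the preservation of a register by a concrete program is proved by
  -- `refl` through `Keeps`.
  assigns : Cmd k → Fin k → Bool
  assigns (x ≔ _)        y = does (x Fin.≟ y)
  assigns (load x _)     y = does (x Fin.≟ y)
  assigns (c ⨾ d)        y = assigns c y ∨ assigns d y
  assigns (ifelse _ c d) y = assigns c y ∨ assigns d y
  assigns (while _ c)    y = assigns c y
  assigns _              y = false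

  setReg-other : ∀ {s : State k} {v} x y → does (x Fin.≟ y) ≡ false → regs (setReg x v s) y ≡ regs s y
  setReg-other {s} x y eq with x Fin.≟ y
  ... | no x≢y = updateAt-minimal y x (regs s) λ e → x≢y (sym e)

  ∨-false : ∀ {a b} → a ∨ b ≡ false → a ≡ false × b ≡ false
  ∨-false {false} {false} _ = refl , refl

  run-keeps : ∀ {c : Cmd k} {s t s′} → Run S W c s t s′ → ∀ y → assigns c y ≡ false → regs s′ y ≡ regs s y
  run-keeps run-skip y eq = refl
  run-keeps (run-≔ {s} {x} _) y eq = setReg-other {s} x y eq
  run-keeps (run-load {s} {x} _) y eq = setReg-other {s} x y eq
  run-keeps (run-store _ _) y eq = refl
  run-keeps (run-⨾ {c = c} r r′) y eq with ∨-false {assigns c y} eq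
  ... | eq₁ , eq₂ = trans (run-keeps r′ y eq₂) (run-keeps r y eq₁)
  run-keeps (run-then {c = c} _ r) y eq = run-keeps r y (proj₁ (∨-false {assigns c y} eq))
  run-keeps (run-else {c = c} _ r) y eq = run-keeps r y (proj₂ (∨-false {assigns c y} eq))
  run-keeps (run-done _) y eq = refl
  run-keeps (run-again _ r r′) y eq = trans (run-keeps r′ y eq) (run-keeps r y eq)

  Keeps : Cmd k → State k → State k → Set
  Keeps c s s′ = ∀ y → assigns c y ≡ false → regs s′ y ≡ regs s y

  exec-keeps : ∀ {c s T Q} → Exec c s T Q → Exec c s T λ s′ → Q s′ × Keeps c s s′
  exec-keeps (_ , _ , r , t≤ , q) = _ , _ , r , t≤ , q , run-keeps r

  setReg-fits : ∀ {s : State k} {v} x → v < W → Fits S W s → Fits S W (setReg x v s)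
  setReg-fits {s} {v} x v< (r< , m<) = (λ y → go (regs s) r< x y) , m<
    where
    go : ∀ {k} (r : Vector ℕ k) → (∀ y → r y < W) → ∀ x y → updateAt r x (const v) y < W
    go r r< zero    zero    = v<
    go r r< zero    (suc y) = r< (suc y)
    go r r< (suc x) zero    = r< zero
    go r r< (suc x) (suc y) = go (λ z → r (suc z)) (λ z → r< (suc z)) x y

  run-fits : ∀ {c : Cmd k} {s t s′} → Run S W c s t s′ → Fits S W s → Fits S W s′
  run-fits run-skip                  fits      = fits
  run-fits (run-≔ {x = x} v<)        fits      = setReg-fits x v< fits
  run-fits (run-load {x = x} a<)     fits      = setReg-fits x (proj₂ fits _ a<) fits
  run-fits (run-store {s} {a} {v} a< v<) (r< , m<) = r< , go
    where
    go : ∀ b → b < S → (if ⟦ a ⟧ₒ s ≡ᵇ b then ⟦ v ⟧ₒ s else mem s b) < W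
    go b b< with ⟦ a ⟧ₒ s ≡ᵇ b
    ... | true  = v<
    ... | false = m< b b<
  run-fits (run-⨾ r r′)              fits      = run-fits r′ (run-fits r fits)
  run-fits (run-then _ r)            fits      = run-fits r fits
  run-fits (run-else _ r)            fits      = run-fits r fits
  run-fits (run-done _)              fits      = fits
  run-fits (run-again _ r r′)        fits      = run-fits r′ (run-fits r fits)

  exec-fits : ∀ {c s T Q} → Fits S W s → Exec c s T Q → Exec c s T λ s′ → Fits S W s′ × Q s′
  exec-fits fits (_ , _ , r , t≤ , q) = _ , _ , r , t≤ , run-fits r fits , q

-- Memory contents and the layout of the nodes

opaque

  -- Opaque, so that memories remain sequences of writes, resolved only by `write-hit` and
  -- `write-miss`.
  write : ℕ → ℕ → (ℕ → ℕ) → ℕ → ℕ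
  write a v μ b = if a ≡ᵇ b then v else μ b

  setMem-write : ∀ {k a a′ v v′ μ} {s : State k} → a ≡ a′ → v ≡ v′ → mem s ≡ μ → mem (setMem a v s) ≡ write a′ v′ μ
  setMem-write refl refl refl = refl

  write-hit : ∀ a {v μ} → write a v μ a ≡ v
  write-hit a rewrite true-≡ᵇ a = refl

  write-miss : ∀ {a b v μ} → a ≢ b → write a v μ b ≡ μ b
  write-miss a≢b rewrite false-≡ᵇ a≢b = refl

-- The halves are interleaved in blocks of eight cells, so the next column is eight cells further on
-- in either half. Listed nodes have index at least 1, hence address at least 8, which leaves 0 free
-- as the null pointer.
off : Fin 2 → ℕ
off h = 4 * toℕ h

-- Node j of half h occupies the cells addr h j + c with c = 0 (row), 1 (column), 2 (next), 3 (character);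
-- node 0 is a sentinel.
addr : Fin 2 → ℕ → ℕ
addr h j = j * 8 + off h

-- Makes `c + addr h j` a mixed-radix number with digits c < 4 and h < 2 and leading part j;
-- `cell-injective` follows by division with remainder.
addr≡ : ∀ h j → addr h j ≡ (toℕ h + j * 2) * 4
addr≡ h j = begin
  j * 8 + 4 * toℕ h        ≡⟨ cong₂ _+_ (sym (*-assoc j 2 4)) (*-comm 4 (toℕ h)) ⟩
  j * 2 * 4 + toℕ h * 4    ≡⟨ *-distribʳ-+ 4 (j * 2) (toℕ h) ⟨
  (j * 2 + toℕ h) * 4      ≡⟨ cong (_* 4) (+-comm (j * 2) (toℕ h)) ⟩
  (toℕ h + j * 2) * 4      ∎
  where open ≡-Reasoning

private
  split4 : ∀ {c c′ m m′} → c < 4 → c′ < 4 → c + m * 4 ≡ c′ + m′ * 4 → c ≡ c′ × m ≡ m′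
  split4 {c} {c′} {m} {m′} c< c′< eq = c≡ , *-cancelʳ-≡ m m′ 4 (+-cancelˡ-≡ c _ _ (trans eq (cong (_+ m′ * 4) (sym c≡))))
    where
    rem : ∀ {c} m → c < 4 → (c + m * 4) % 4 ≡ c
    rem {c} m c< = trans ([m+kn]%n≡m%n c m 4) (m<n⇒m%n≡m c<)
    c≡ : c ≡ c′
    c≡ = trans (sym (rem m c<)) (trans (cong (_% 4) eq) (rem m′ c′<))

  split2 : ∀ (h h′ : Fin 2) j j′ → toℕ h + j * 2 ≡ toℕ h′ + j′ * 2 → h ≡ h′ × j ≡ j′
  split2 h h′ j j′ eq = Fin.toℕ-injective h≡ , *-cancelʳ-≡ j j′ 2 (+-cancelˡ-≡ (toℕ h) _ _ (trans eq (cong (_+ j′ * 2) (sym h≡))))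
    where
    rem : ∀ (h : Fin 2) j → (toℕ h + j * 2) % 2 ≡ toℕ h
    rem h j = trans ([m+kn]%n≡m%n (toℕ h) j 2) (m<n⇒m%n≡m (Fin.toℕ<n h))
    h≡ : toℕ h ≡ toℕ h′
    h≡ = trans (sym (rem h j)) (trans (cong (_% 2) eq) (rem h′ j′))

cell-injective : ∀ {c c′ h h′ j j′} → c < 4 → c′ < 4 → c + addr h j ≡ c′ + addr h′ j′ → c ≡ c′ × h ≡ h′ × j ≡ j′
cell-injective {c} {c′} {h} {h′} {j} {j′} c< c′< eq
  with split4 c< c′< (trans (cong (c +_) (sym (addr≡ h j))) (trans eq (cong (c′ +_) (addr≡ h′ j′))))
... | c≡ , m≡ = c≡ , split2 h h′ j j′ m≡

addr-mono : ∀ h {j j′} → j ≤ j′ → addr h j ≤ addr h j′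
addr-mono h j≤ = +-monoˡ-≤ (off h) (*-monoˡ-≤ 8 j≤)

addr-< : ∀ h {j j′} → j < j′ → addr h j < addr h j′
addr-< h j< = +-monoˡ-< (off h) (*-monoˡ-< 8 j<)

off≤4 : ∀ h → off h ≤ 4
off≤4 h = *-monoʳ-≤ 4 (s≤s⁻¹ (Fin.toℕ<n h))

cell-bound : ∀ {n} h {j c} → j ≤ n → c < 4 → c + addr h j < 8 * suc n
cell-bound {n} h {j} {c} j≤n c<4 = begin-strict
  c + addr h j          <⟨ +-mono-<-≤ c<4 (+-mono-≤ (*-monoˡ-≤ 8 j≤n) (off≤4 h)) ⟩
  4 + (n * 8 + 4)       ≡⟨ cong (4 +_) (+-comm (n * 8) 4) ⟩
  suc n * 8             ≡⟨ *-comm (suc n) 8 ⟩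
  8 * suc n             ∎
  where open ≤-Reasoning

-- The instruction set has no multiplication; a node index becomes an address by three doublings.
double-double-double : ∀ t → let u = t + t in (u + u) + (u + u) ≡ t * 8
double-double-double t = begin
  (t + t + (t + t)) + (t + t + (t + t)) ≡⟨ cong (λ u → u + u + (u + u)) (twice t) ⟩
  (t * 2 + t * 2) + (t * 2 + t * 2)     ≡⟨ cong (λ u → u + u) (twice (t * 2)) ⟩
  t * 2 * 2 + t * 2 * 2                 ≡⟨ twice (t * 2 * 2) ⟩
  t * 2 * 2 * 2                         ≡⟨ *-assoc (t * 2) 2 2 ⟩
  t * 2 * 4                             ≡⟨ *-assoc t 2 4 ⟩
  t * 8                                 ∎
  where
  open ≡-Reasoning
  twice : ∀ t → t + t ≡ t * 2
  twice t = trans (cong (t +_) (sym (+-identityʳ t))) (*-comm 2 t)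

-- The update program

Reg : Set
Reg = Fin 12

-- `rN` holds n + 1, so that subtracting a row or column from it mirrors it, and `rEnd` the address
-- of column n. During the pass, `rCur` runs through the old list, `rPrev` is the last node of the
-- new list, `rLast` the column emitted last, and `rHold` the hand; `rVal` and `rPos` pass a row and
-- a node to `emit`, and `rT`, `rU` are scratch.
rArg rHead rN rEnd rCur rPrev rLast rHold rVal rPos rT rU : Reg
rArg  = # 0
rHead = # 1
rN    = # 2
rEnd  = # 3
rCur  = # 4
rPrev = # 5
rLast = # 6
rHold = # 7
rVal  = # 8
rPos  = # 9
rT    = # 10
rU    = # 11

octuple : Fin 2 → Cmd 12
octuple h = rT ≔ reg rT ⊕ reg rT ⨾ rT ≔ reg rT ⊕ reg rT ⨾ rT ≔ reg rT ⊕ reg rT ⨾ rT ≔ reg rT ⊕ lit (off h)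

mirror-addr : Operand 12 → Fin 2 → Cmd 12
mirror-addr a h = rT ≔ reg rN ⊖ a ⨾ octuple h

-- The column number comes from the key cell, because the machine cannot divide an address by 8.
-- `link` enters the mirrored row in the other half and then attaches the node to the new list.
mirror-key link : Cmd 12
mirror-key = rT ≔ lit 1 ⊕ reg rPos ⨾ load rU (reg rT) ⨾ rU ≔ reg rN ⊖ reg rU
link       = store (reg rT) (reg rU) ⨾ rT ≔ lit 2 ⊕ reg rPrev ⨾ store (reg rT) (reg rPos) ⨾ rPrev ≔ val (reg rPos)

-- Gives the column at rPos the row in rVal, in both halves; a column with row 0 is left out of the new list.
emit : Fin 2 → Cmd 12
emit g =
  store (reg rPos) (reg rVal) ⨾
  ifelse (lit 0 ≺ reg rVal) (mirror-key ⨾ mirror-addr (reg rVal) g ⨾ link) skip ⨾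
  rLast ≔ val (reg rPos)

-- `read` advances `rCur` before its node is rewritten, because the new list reuses the nodes of the
-- old one.
exchange read select release : Cmd 12
exchange = rT ≔ val (reg rHold) ⨾ rHold ≔ val (reg rVal) ⨾ rVal ≔ val (reg rT)
read     = load rVal (reg rCur) ⨾ rT ≔ lit 3 ⊕ reg rCur ⨾ load rT (reg rT) ⨾ rPos ≔ val (reg rCur) ⨾
           rU ≔ lit 2 ⊕ reg rCur ⨾ load rCur (reg rU)
select   = ifelse (reg rT ≐ reg rArg) exchange (ifelse (reg rVal ≺ reg rHold) exchange skip)
release  = rVal ≔ val (reg rHold) ⨾ rHold ≔ val (lit 0) ⨾ rPos ≔ lit 8 ⊕ reg rLast

following close advance cut : Cmd 12
following = rT ≔ lit 8 ⊕ reg rLast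
close     = rT ≔ lit 2 ⊕ reg rPrev ⨾ store (reg rT) (lit 0)
advance   = rPrev ≔ val (reg rCur) ⨾ rU ≔ lit 2 ⊕ reg rCur ⨾ load rCur (reg rU)
cut       = rU ≔ lit 2 ⊕ reg rCur ⨾ load rU (reg rU) ⨾ rT ≔ lit 2 ⊕ reg rPrev ⨾ store (reg rT) (reg rU)

setup : Fin 2 → Cmd 12
setup f = rEnd ≔ val (reg rT) ⨾ rPrev ≔ val (lit (off f)) ⨾ rLast ≔ val (lit (off f)) ⨾
          rHold ≔ val (lit 0) ⨾ load rCur (lit (2 + off f))

-- The held strand of a nonzero row goes into the column after rLast if that column is not in the old list.
consume place body finish pass splice-loop splice : Fin 2 → Cmd 12
consume g = read ⨾ select ⨾ emit g
place   g = release ⨾ emit g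
body    g = ifelse (lit 0 ≺ reg rHold)
              (following ⨾ ifelse (reg rT ≺ reg rCur) (place g) (consume g))
              (consume g)
finish  g = ifelse (lit 0 ≺ reg rHold) (ifelse (reg rLast ≺ reg rEnd) (place g) skip) skip ⨾ close

pass g = while (lit 0 ≺ reg rCur) (body g) ⨾ finish g

splice-loop g = while (reg rCur ≺ reg rT) advance ⨾ cut

splice g = ifelse (lit 0 ≺ reg rHold)
  (mirror-addr (reg rHold) g ⨾ rPrev ≔ val (lit (off g)) ⨾ load rCur (lit (2 + off g)) ⨾ splice-loop g)
  skip

-- `f` is the half whose string receives a character on the right, `g` the mirrored one. Cell 2 is
-- the `next` cell of the sentinel of half 0, whose list is the one to be exposed whichever half is
-- `f`.
update : Fin 2 → Fin 2 → Cmd 12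
update f g = (mirror-addr (lit 1) f ⨾ setup f) ⨾ pass g ⨾ splice g ⨾ load rHead (lit 2)

-- The linked list through the columns j + 1, …, n of half h where p is positive.
data Chain (n : ℕ) (h : Fin 2) (μ p : ℕ → ℕ) : ℕ → ℕ → Set where
  end  : Chain n h μ p n 0
  skip : ∀ {j a} → p (suc j) ≡ 0 → Chain n h μ p (suc j) a → Chain n h μ p j a
  take : ∀ {j} → 0 < p (suc j) → Chain n h μ p (suc j) (μ (2 + addr h (suc j))) → Chain n h μ p j (addr h (suc j))

module _ {n : ℕ} {h : Fin 2} {μ p : ℕ → ℕ} where

  takes : ∀ {j a} → Chain n h μ p j a → ℕ
  takes end        = 0
  takes (skip _ C) = takes C
  takes (take _ C) = suc (takes C)

  -- At j = 0 this is the length of the list, which `Pivots-size` turns into Δ.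
  takes-count : ∀ {j a} (C : Chain n h μ p j a) → takes C + count p 0 j ≡ count p 0 n
  takes-count end = refl
  takes-count {j} (skip eq C) = trans
    (cong (takes C +_) (sym (trans (cong (count p 0 j +_) (above-≥ (≤-reflexive eq))) (+-identityʳ _)))) (takes-count C)
  takes-count {j} (take lt C) = trans (trans (sym (+-suc (takes C) (count p 0 j)))
    (cong (takes C +_) (trans (+-comm 1 _) (cong (count p 0 j +_) (sym (above-< lt)))))) (takes-count C)

  chain-≤ : ∀ {j a} → Chain n h μ p j a → j ≤ n
  chain-≤ end        = ≤-refl
  chain-≤ (skip _ C) = <⇒≤ (chain-≤ C)
  chain-≤ (take _ C) = <⇒≤ (chain-≤ C)

  chain-addr : ∀ {j a} → Chain n h μ p j a → a ≡ 0 ⊎ addr h (suc j) ≤ a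
  chain-addr end        = inj₁ refl
  chain-addr (take _ _) = inj₂ ≤-refl
  chain-addr {j} (skip _ C) with chain-addr C
  ... | inj₁ eq = inj₁ eq
  ... | inj₂ le = inj₂ (≤-trans (addr-mono h (n≤1+n (suc j))) le)

-- Words of twice the memory size 8 (n + 1) leave room for a step of eight cells beyond any node and
-- for the address computed from index n + 1.
module Arithmetic (n W : ℕ) (big : 16 * suc n ≤ W) where

  <W : ∀ {a} → a < 16 * suc n → a < W
  <W lt = <-≤-trans lt big

  8≤16 : 8 * suc n ≤ 16 * suc n
  8≤16 = *-monoˡ-≤ (suc n) (m≤m+n 8 8)

  cell<W : ∀ h {j c} → j ≤ n → c < 4 → c + addr h j < W
  cell<W h j≤n c<4 = <W (<-≤-trans (cell-bound h j≤n c<4) 8≤16)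

  8+addr<W : ∀ h {j} → j ≤ n → 8 + addr h j < W
  8+addr<W h {j} j≤n = <W (begin-strict
    8 + addr h j            <⟨ +-monoʳ-< 8 (cell-bound {n} h j≤n z<s) ⟩
    8 + 8 * suc n           ≤⟨ +-monoˡ-≤ (8 * suc n) (m≤m*n 8 (suc n)) ⟩
    8 * suc n + 8 * suc n   ≡⟨ *-distribʳ-+ (suc n) 8 8 ⟨
    16 * suc n              ∎)
    where open ≤-Reasoning

  index<W : ∀ {j} → j ≤ suc n → j < W
  index<W {j} j≤ = <W (begin-strict
    j            ≤⟨ j≤ ⟩
    suc n        <⟨ m<m+n (suc n) z<s ⟩
    suc n + 15 * suc n ∎)
    where open ≤-Reasoning

  octuple<W : ∀ h {i} → i ≤ suc n → let j = i + i in
               j < W × j + j < W × (j + j) + (j + j) < W × ((j + j) + (j + j)) + off h < W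
  octuple<W h {i} i≤ = below (≤-trans (m≤m+n (i + i) _) (m≤m+n _ _)) , below (m≤m+n _ _) , below ≤-refl ,
    <W (begin-strict
      i₈ + off h           ≤⟨ +-mono-≤ i₈≤ (off≤4 h) ⟩
      8 * suc n + 4        <⟨ +-monoʳ-< (8 * suc n) (<-≤-trans (m<m+n 4 {4} z<s) (m≤m*n 8 (suc n))) ⟩
      8 * suc n + 8 * suc n ≡⟨ *-distribʳ-+ (suc n) 8 8 ⟨
      16 * suc n ∎)
    where
    open ≤-Reasoning
    i₈ = ((i + i) + (i + i)) + ((i + i) + (i + i))
    i₈≤ : i₈ ≤ 8 * suc n
    i₈≤ = subst (_≤ 8 * suc n) (sym (trans (double-double-double i) (*-comm i 8))) (*-monoʳ-≤ 8 i≤)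
    below : ∀ {a} → a ≤ i₈ → a < W
    below a≤ = <W (≤-<-trans (≤-trans a≤ i₈≤) (*-monoˡ-< (suc n) (m<m+n 8 {8} z<s)))

module Emit (n W : ℕ) (big : 16 * suc n ≤ W) (f g : Fin 2) where

  open Arithmetic n W big
  open Machine (8 * suc n) W {12}

  mirror-key-exec : ∀ {j} s → j < n → regs s rN ≡ suc n → regs s rPos ≡ addr f (suc j) →
                    mem s (1 + addr f (suc j)) ≡ suc j →
                    Exec mirror-key s 3 λ s′ → regs s′ rU ≡ suc n ∸ suc j × mem s′ ≡ mem s
  mirror-key-exec {j} s j<n N≡ pos≡ key≡ = exec mirror-key
    ( subst (λ a → 1 + a < W) (sym pos≡) (cell<W f j<n (s≤s z<s))
    , subst (λ a → 1 + a < 8 * suc n) (sym pos≡) (cell-bound {n} f j<n (s≤s z<s))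
    , subst (λ a → a ∸ mem s (1 + regs s rPos) < W) (sym N≡) (index<W (m∸n≤m (suc n) (mem s (1 + regs s rPos))))
    , cong₂ _∸_ N≡ (trans (cong (λ a → mem s (1 + a)) pos≡) key≡) , refl )

  octuple-exec : ∀ h s → regs s rT ≤ suc n →
                 Exec (octuple h) s 4 λ s′ → regs s′ rT ≡ addr h (regs s rT) × mem s′ ≡ mem s
  octuple-exec h s i≤ with octuple<W h i≤
  ... | b₁ , b₂ , b₃ , b₄ = exec (octuple h) (b₁ , b₂ , b₃ , b₄ , cong (_+ off h) (double-double-double (regs s rT)) , refl)

  mirror-addr-exec : ∀ h {v} a s → regs s rN ≡ suc n → ⟦ a ⟧ₒ s ≡ v →
                     Exec (mirror-addr a h) s 5 λ s′ → regs s′ rT ≡ addr h (suc n ∸ v) × mem s′ ≡ mem s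
  mirror-addr-exec h {v} a s N≡ v≡ = exec-⨾
    (exec (rT ≔ reg rN ⊖ a) {s} {λ s′ → regs s′ rT ≡ suc n ∸ v × mem s′ ≡ mem s}
      (subst (λ N → N ∸ ⟦ a ⟧ₒ s < W) (sym N≡) (index<W (m∸n≤m (suc n) (⟦ a ⟧ₒ s))) , cong₂ _∸_ N≡ v≡ , refl))
    λ { s₁ (t≡ , m≡) → exec-map ≤-refl
          (λ { _ (t≡′ , m≡′) → trans t≡′ (cong (addr h) t≡) , trans m≡′ m≡ })
          (octuple-exec h s₁ (subst (_≤ suc n) (sym t≡) (m∸n≤m (suc n) v))) }

  link-exec : ∀ {j m i w} s → j < n → m ≤ n → i ≤ n → w ≤ suc n → regs s rT ≡ addr g i → regs s rU ≡ w →
              regs s rPos ≡ addr f (suc j) → regs s rPrev ≡ addr f m →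
              Exec link s 4 λ s′ → regs s′ rPrev ≡ addr f (suc j) ×
                mem s′ ≡ write (2 + addr f m) (addr f (suc j)) (write (addr g i) w (mem s))
  link-exec {j} {m} {i} {w} s j<n m≤n i≤n w≤ t≡ u≡ pos≡ prev≡ = exec link
    ( subst (_< 8 * suc n) (sym t≡) (cell-bound {n} g i≤n z<s)
    , subst (_< W) (sym u≡) (index<W w≤)
    , subst (λ a → 2 + a < W) (sym prev≡) (cell<W f m≤n (s≤s (s≤s z<s)))
    , subst (λ a → 2 + a < 8 * suc n) (sym prev≡) (cell-bound {n} f m≤n (s≤s (s≤s z<s)))
    , pos<W , pos<W
    , pos≡
    , setMem-write {s = setReg rT (2 + regs s rPrev) (setMem (regs s rT) (regs s rU) s)} (cong (2 +_) prev≡) pos≡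
        (setMem-write {s = s} t≡ u≡ refl) )
    where
    pos<W : regs s rPos < W
    pos<W = subst (_< W) (sym pos≡) (cell<W f j<n z<s)

  record Emitted (j m v : ℕ) (s s′ : State 12) : Set where
    field
      last≡ : regs s′ rLast ≡ addr f (suc j)
      mem≡  : (v ≡ 0 × regs s′ rPrev ≡ regs s rPrev × mem s′ ≡ write (addr f (suc j)) v (mem s))
            ⊎ (0 < v × regs s′ rPrev ≡ addr f (suc j) ×
               mem s′ ≡ write (2 + addr f m) (addr f (suc j))
                          (write (addr g (suc n ∸ v)) (suc n ∸ suc j) (write (addr f (suc j)) v (mem s))))

  emit-exec : ∀ {j m v} s → j < n → m ≤ n → v ≤ n → regs s rN ≡ suc n → regs s rPos ≡ addr f (suc j) →
              regs s rVal ≡ v → regs s rPrev ≡ addr f m → mem s (1 + addr f (suc j)) ≡ suc j →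
              Exec (emit g) s 15 λ s′ → Emitted j m v s s′ × Keeps (emit g) s s′
  emit-exec {j} {m} {v} s j<n m≤n v≤n N≡ pos≡ val≡ prev≡ key≡ = exec-keeps (exec-⨾
    (exec-keeps (exec (store (reg rPos) (reg rVal)) {s} {λ s₁ → mem s₁ ≡ write (addr f (suc j)) v (mem s)}
      ( subst (_< 8 * suc n) (sym pos≡) (cell-bound {n} f j<n z<s)
      , subst (_< W) (sym val≡) (index<W (m≤n⇒m≤1+n v≤n))
      , setMem-write {s = s} pos≡ val≡ refl )))
    λ { s₁ (m₁ , k₁) → exec-⨾
      (exec-keeps {Q = λ s₂ → (v ≡ 0 × regs s₂ rPrev ≡ regs s rPrev × mem s₂ ≡ write (addr f (suc j)) v (mem s))
            ⊎ (0 < v × regs s₂ rPrev ≡ addr f (suc j) ×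
               mem s₂ ≡ write (2 + addr f m) (addr f (suc j))
                          (write (addr g (suc n ∸ v)) (suc n ∸ suc j) (write (addr f (suc j)) v (mem s))))}
        (exec-if {T = 12}
          (λ pos → exec-map ≤-refl (λ { _ (p≡ , m≡) → inj₂ (0<v s₁ k₁ pos , p≡ , m≡) }) (linking s₁ m₁ k₁ (0<v s₁ k₁ pos)))
          (λ zer → exec-map (s≤s z≤n) (λ { _ refl →
            inj₁ (n≤0⇒n≡0 (subst (_≤ 0) (trans (k₁ rVal refl) val≡) (<ᵇ-false zer)) , k₁ rPrev refl , m₁) })
            (exec skip {s₁} {_≡ s₁} refl))))
      λ { s₂ (m₂ , k₂) → exec (rLast ≔ val (reg rPos))
        ( subst (_< W) (sym (pos₂ s₁ s₂ k₁ k₂)) (cell<W f j<n z<s)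
        , record { last≡ = pos₂ s₁ s₂ k₁ k₂ ; mem≡ = m₂ } ) } })
    where
    pos₂ : ∀ s₁ s₂ → Keeps (store (reg rPos) (reg rVal)) s s₁ →
           Keeps (ifelse (lit 0 ≺ reg rVal) (mirror-key ⨾ mirror-addr (reg rVal) g ⨾ link) skip) s₁ s₂ →
           regs s₂ rPos ≡ addr f (suc j)
    pos₂ s₁ s₂ k₁ k₂ = trans (k₂ rPos refl) (trans (k₁ rPos refl) pos≡)
    0<v : ∀ s₁ → Keeps (store (reg rPos) (reg rVal)) s s₁ → (0 <ᵇ regs s₁ rVal) ≡ true → 0 < v
    0<v s₁ k₁ pos = subst (0 <_) (trans (k₁ rVal refl) val≡) (<ᵇ-true pos)
    linking : ∀ s₁ → mem s₁ ≡ write (addr f (suc j)) v (mem s) → Keeps (store (reg rPos) (reg rVal)) s s₁ → 0 < v →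
              Exec (mirror-key ⨾ mirror-addr (reg rVal) g ⨾ link) s₁ 12 λ s₂ → regs s₂ rPrev ≡ addr f (suc j) ×
               mem s₂ ≡ write (2 + addr f m) (addr f (suc j))
                          (write (addr g (suc n ∸ v)) (suc n ∸ suc j) (write (addr f (suc j)) v (mem s)))
    linking s₁ m₁ k₁ 0<v = exec-⨾
      (exec-keeps (mirror-key-exec s₁ j<n (trans (k₁ rN refl) N≡) (trans (k₁ rPos refl) pos≡)
        (trans (cong (λ μ → μ (1 + addr f (suc j))) m₁) (trans (write-miss (λ e → 1+n≢n (sym e))) key≡))))
      λ { s₂ ((u₂ , m₂) , k₂) → exec-⨾
        (exec-keeps (mirror-addr-exec g (reg rVal) s₂ (trans (k₂ rN refl) (trans (k₁ rN refl) N≡))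
                                           (trans (k₂ rVal refl) (trans (k₁ rVal refl) val≡))))
        λ { s₃ ((t₃ , m₃) , k₃) → exec-map ≤-refl
            (λ { _ (p₄ , m₄) → p₄ , trans m₄ (cong (λ μ → write (2 + addr f m) (addr f (suc j))
                                (write (addr g (suc n ∸ v)) (suc n ∸ suc j) μ)) (trans m₃ (trans m₂ m₁))) })
            (link-exec s₃ j<n m≤n (s≤s⁻¹ (∸-monoʳ-< {o = 0} 0<v (m≤n⇒m≤1+n v≤n))) (m∸n≤m (suc n) (suc j)) t₃
              (trans (k₃ rU refl) u₂)
              (trans (k₃ rPos refl) (trans (k₂ rPos refl) (trans (k₁ rPos refl) pos≡)))
              (trans (k₃ rPrev refl) (trans (k₂ rPrev refl) (trans (k₁ rPrev refl) prev≡)))) } }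

-- The walk along the first list

module Pass (n W : ℕ) (big : 16 * suc n ≤ W) (f g : Fin 2) (f≢g : f ≢ g)
            (c : ℕ → ℕ) (x : ℕ) (p q′ : ℕ → ℕ) (p≤ : ∀ j → p j ≤ j)
            (mirrors : ∀ {b} → 0 < b → b ≤ n → 0 < comb c x p b → q′ (suc n ∸ comb c x p b) ≡ suc n ∸ b)
            (μ₀ : ℕ → ℕ)
            (keys : ∀ {b} → b < n → μ₀ (1 + addr f (suc b)) ≡ suc b)
            (chars : ∀ {b} → b < n → μ₀ (3 + addr f (suc b)) ≡ c b)
            (rows₀ : ∀ {b} → b < n → 0 < p (suc b) → μ₀ (addr f (suc b)) ≡ p (suc b)) where

  open Arithmetic n W big
  open Machine (8 * suc n) W {12}
  open Emit n W big f g

  private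
    H = hold c x p
    p′ = comb c x p

  -- The cells that processing the columns after j preserves; a is the address of the last node
  -- of the new list.
  record Frame (j a : ℕ) (μ μ′ : ℕ → ℕ) : Set where
    field
      key   : ∀ h b → μ′ (1 + addr h b) ≡ μ (1 + addr h b)
      char  : ∀ h b → μ′ (3 + addr h b) ≡ μ (3 + addr h b)
      next  : ∀ b → μ′ (2 + addr g b) ≡ μ (2 + addr g b)
      row   : ∀ {b} → b ≤ j → μ′ (addr f b) ≡ μ (addr f b)
      next₁ : ∀ {b} → b ≤ j → addr f b ≢ a → μ′ (2 + addr f b) ≡ μ (2 + addr f b)

  open Frame

  -- `last≡` is claimed only for a nonempty hand: gaps met with an empty hand are passed without any
  -- machine step, and `rLast` falls behind. `m` is the column of the last node of the new list, or
  -- 0 for the sentinel; by `same` the columns ahead are still as in `μ₀`.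
  record Inv (j : ℕ) (s : State 12) : Set where
    field
      N≡    : regs s rN ≡ suc n
      end≡  : regs s rEnd ≡ addr f n
      arg≡  : regs s rArg ≡ x
      hold≡ : regs s rHold ≡ H j
      last≡ : 0 < H j → regs s rLast ≡ addr f j
      m     : ℕ
      m≤    : m ≤ j
      prev≡ : regs s rPrev ≡ addr f m
      same  : ∀ {b e} → j < b → e < 4 → mem s (e + addr f b) ≡ μ₀ (e + addr f b)
      rows′ : ∀ {b} → 0 < b → b ≤ j → 0 < p′ b → mem s (addr g (suc n ∸ p′ b)) ≡ q′ (suc n ∸ p′ b)

  -- Relative to the state `s` in which column j has been dealt with: the new list continues in the
  -- `next` cell of the node that was last in `s`. In this form the induction over the old list can
  -- put one column in front.
  record Post (j : ℕ) (s s′ : State 12) : Set where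
    field
      N≡    : regs s′ rN ≡ suc n
      hold≡ : regs s′ rHold ≡ H n
      chain : Chain n f (mem s′) p′ j (mem s′ (2 + regs s rPrev))
      rows  : ∀ {b} → j < b → b ≤ n → 0 < p′ b → mem s′ (addr f b) ≡ p′ b
      rows′ : ∀ {b} → 0 < b → b ≤ n → 0 < p′ b → mem s′ (addr g (suc n ∸ p′ b)) ≡ q′ (suc n ∸ p′ b)
      frame : Frame j (regs s rPrev) (mem s) (mem s′)

  swap-yes : ∀ {j} → swaps x (c j) (p (suc j)) (H j) ≡ true → p′ (suc j) ≡ H j × H (suc j) ≡ p (suc j)
  swap-yes eq rewrite eq = refl , refl

  swap-no : ∀ {j} → swaps x (c j) (p (suc j)) (H j) ≡ false → p′ (suc j) ≡ p (suc j) × H (suc j) ≡ H j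
  swap-no eq rewrite eq = refl , refl

  -- In a column of row 0 the character makes no difference: a match exchanges, and otherwise 0 is
  -- the minimum. So `release` acts without reading the column.
  gap-swap : ∀ {j} → p (suc j) ≡ 0 → p′ (suc j) ≡ H j × H (suc j) ≡ 0
  gap-swap {j} p≡0 with swaps x (c j) (p (suc j)) (H j) in eq
  ... | true  = refl , p≡0
  ... | false rewrite p≡0 with c j ≡ᵇ x
  ...   | true with eq
  ...     | ()
  gap-swap {j} p≡0 | false | false = sym H≡0 , H≡0
    where
    H≡0 : H j ≡ 0
    H≡0 = n≤0⇒n≡0 (<ᵇ-false eq)

  private
    0<4 : 0 < 4
    0<4 = z<s
    1<4 : 1 < 4
    1<4 = s≤s z<s
    2<4 : 2 < 4
    2<4 = s≤s (s≤s z<s)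
    3<4 : 3 < 4
    3<4 = s≤s (s≤s (s≤s z<s))

    miss-cell : ∀ {e e′} h h′ b b′ → e < 4 → e′ < 4 → e ≢ e′ → e + addr h b ≢ e′ + addr h′ b′
    miss-cell h h′ b b′ e< e′< e≢ eq = e≢ (proj₁ (cell-injective {h = h} {h′} {b} {b′} e< e′< eq))

    miss-half : ∀ {e e′} h h′ b b′ → e < 4 → e′ < 4 → h ≢ h′ → e + addr h b ≢ e′ + addr h′ b′
    miss-half h h′ b b′ e< e′< h≢ eq = h≢ (proj₁ (proj₂ (cell-injective {h = h} {h′} {b} {b′} e< e′< eq)))

    miss-index : ∀ {e e′} h h′ b b′ → e < 4 → e′ < 4 → b ≢ b′ → e + addr h b ≢ e′ + addr h′ b′
    miss-index h h′ b b′ e< e′< b≢ eq = b≢ (proj₂ (proj₂ (cell-injective {h = h} {h′} {b} {b′} e< e′< eq)))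

    _↯_ : ∀ {a b v μ w} → a ≢ b → μ b ≡ w → write a v μ b ≡ w
    ne ↯ eq = trans (write-miss ne) eq

    infixr 5 _↯_

  frame-weaken : ∀ {j a μ μ′} → Frame (suc j) a μ μ′ → Frame j a μ μ′
  frame-weaken F = record
    { key = key F ; char = char F ; next = next F
    ; row = λ b≤ → row F (m≤n⇒m≤1+n b≤) ; next₁ = λ b≤ → next₁ F (m≤n⇒m≤1+n b≤) }

  frame-trans : ∀ {j a a′ μ μ′ μ″} → (∀ {b} → b ≤ j → addr f b ≢ a → addr f b ≢ a′) →
                Frame j a μ μ′ → Frame (suc j) a′ μ′ μ″ → Frame j a μ μ″
  frame-trans a≢ F F′ = record
    { key = λ h b → trans (key F′ h b) (key F h b)
    ; char = λ h b → trans (char F′ h b) (char F h b)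
    ; next = λ b → trans (next F′ b) (next F b)
    ; row = λ b≤ → trans (row F′ (m≤n⇒m≤1+n b≤)) (row F b≤)
    ; next₁ = λ b≤ ne → trans (next₁ F′ (m≤n⇒m≤1+n b≤) (a≢ b≤ ne)) (next₁ F b≤ ne) }

  later : ∀ {b j} → b ≤ j → suc j ≢ b
  later b≤j refl = <-irrefl refl b≤j

  row-frame : ∀ {j} a {v μ} → Frame j a μ (write (addr f (suc j)) v μ)
  row-frame {j} a = record
    { key = λ h b → miss-cell f h (suc j) b 0<4 1<4 (λ ()) ↯ refl
    ; char = λ h b → miss-cell f h (suc j) b 0<4 3<4 (λ ()) ↯ refl
    ; next = λ b → miss-cell f g (suc j) b 0<4 2<4 (λ ()) ↯ refl
    ; row = λ {b} b≤ → miss-index f f (suc j) b 0<4 0<4 (later b≤) ↯ refl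
    ; next₁ = λ {b} _ _ → miss-cell f f (suc j) b 0<4 2<4 (λ ()) ↯ refl }

  link-frame : ∀ {j m v v′ i w μ} →
               Frame j (addr f m) μ (write (2 + addr f m) w (write (addr g i) v (write (addr f (suc j)) v′ μ)))
  link-frame {j} {m} {i = i} = record
    { key = λ h b → miss-cell f h m b 2<4 1<4 (λ ()) ↯ miss-cell g h i b 0<4 1<4 (λ ()) ↯ key (row-frame {j} (addr f m)) h b
    ; char = λ h b → miss-cell f h m b 2<4 3<4 (λ ()) ↯ miss-cell g h i b 0<4 3<4 (λ ()) ↯ char (row-frame {j} (addr f m)) h b
    ; next = λ b → miss-half f g m b 2<4 2<4 f≢g ↯ miss-cell g g i b 0<4 2<4 (λ ()) ↯ next (row-frame {j} (addr f m)) b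
    ; row = λ {b} b≤ → miss-cell f f m b 2<4 0<4 (λ ()) ↯ miss-half g f i b 0<4 0<4 (λ e → f≢g (sym e)) ↯
                row (row-frame {j} (addr f m)) b≤
    ; next₁ = λ {b} b≤ ne → (λ e → ne (sym (+-cancelˡ-≡ 2 _ _ e))) ↯ miss-cell g f i b 0<4 2<4 (λ ()) ↯
                next₁ (row-frame {j} (addr f m)) b≤ ne }

  -- `back` extends the final assertion for the columns after j + 1 by column j + 1 itself.
  record Stepped (j a : ℕ) (s s′ : State 12) : Set where
    field
      inv  : Inv (suc j) s′
      cur≡ : regs s′ rCur ≡ a
      back : ∀ {s″} → Post (suc j) s′ s″ → Post j s s″

  -- The common end of `consume` and `place`: `s₀` is the state before the column, `s` the one in
  -- which the new row and the new hand are in registers and the memory is still that of `s₀`.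
  emit-step : ∀ {j a s₀} s → j < n → Inv j s₀ → mem s ≡ mem s₀ → regs s rN ≡ regs s₀ rN → regs s rEnd ≡ regs s₀ rEnd →
              regs s rArg ≡ regs s₀ rArg → regs s rPrev ≡ regs s₀ rPrev → regs s rCur ≡ a →
              regs s rPos ≡ addr f (suc j) → regs s rVal ≡ p′ (suc j) → regs s rHold ≡ H (suc j) →
              Exec (emit g) s 15 (Stepped j a s₀)
  emit-step {j} {a} {s₀} s j<n I mem≡ N≡ end≡ arg≡ prev≡ cur≡ pos≡ val≡ hold≡ =
    exec-map ≤-refl (λ { s′ (E , K) → step s′ E K })
      (emit-exec s j<n (≤-trans I.m≤ (<⇒≤ j<n)) v≤n (trans N≡ I.N≡) pos≡ val≡ (trans prev≡ I.prev≡)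
        (trans (cong (λ μ → μ (1 + addr f (suc j))) mem≡) (trans (I.same ≤-refl 1<4) (keys j<n))))
    where
    module I = Inv I
    v = p′ (suc j)
    v≤n : v ≤ n
    v≤n = ≤-trans (Comb.comb≤ c x p p≤ (suc j)) j<n
    step : ∀ s′ → Emitted j I.m v s s′ → Keeps (emit g) s s′ → Stepped j a s₀ s′
    step s′ E K with Emitted.mem≡ E
    ... | inj₁ (v≡0 , prev≡′ , mem≡′) = record { inv = inv ; cur≡ = trans (K rCur refl) cur≡ ; back = back }
      where
      mem′ : mem s′ ≡ write (addr f (suc j)) v (mem s₀)
      mem′ = trans mem≡′ (cong (write _ _) mem≡)
      prev′ : regs s′ rPrev ≡ regs s₀ rPrev
      prev′ = trans prev≡′ prev≡
      inv : Inv (suc j) s′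
      inv = record
        { N≡ = trans (K rN refl) (trans N≡ I.N≡) ; end≡ = trans (K rEnd refl) (trans end≡ I.end≡)
        ; arg≡ = trans (K rArg refl) (trans arg≡ I.arg≡) ; hold≡ = trans (K rHold refl) hold≡
        ; last≡ = λ _ → Emitted.last≡ E ; m = I.m ; m≤ = m≤n⇒m≤1+n I.m≤ ; prev≡ = trans prev′ I.prev≡
        ; same = λ {b} {e} b> e< → trans (cong (λ μ → μ (e + addr f b)) mem′)
            (miss-index f f (suc j) b 0<4 e< (λ eq → <-irrefl eq b>) ↯ I.same (<⇒≤ b>) e<)
        ; rows′ = λ {b} → rows′ b }
        where
        rows′ : ∀ b → 0 < b → b ≤ suc j → 0 < p′ b → mem s′ (addr g (suc n ∸ p′ b)) ≡ q′ (suc n ∸ p′ b)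
        rows′ b 0<b b≤ 0<p with m≤n⇒m<n∨m≡n b≤
        ... | inj₂ refl = ⊥-elim (<-irrefl (sym v≡0) 0<p)
        ... | inj₁ (s≤s b≤j) = trans (cong (λ μ → μ (addr g (suc n ∸ p′ b))) mem′)
            (miss-half f g (suc j) (suc n ∸ p′ b) 0<4 0<4 f≢g ↯ I.rows′ 0<b b≤j 0<p)
      back : ∀ {s″} → Post (suc j) s′ s″ → Post j s₀ s″
      back {s″} P = record
        { N≡ = P.N≡ ; hold≡ = P.hold≡
        ; chain = skip v≡0 (subst (λ r → Chain n f (mem s″) p′ (suc j) (mem s″ (2 + r))) prev′ P.chain)
        ; rows = λ {b} → rows b ; rows′ = P.rows′
        ; frame = frame-trans (λ _ ne e → ne (trans e prev′))
            (subst (Frame j (regs s₀ rPrev) (mem s₀)) (sym mem′) (row-frame (regs s₀ rPrev))) P.frame }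
        where
        module P = Post P
        rows : ∀ b → j < b → b ≤ n → 0 < p′ b → mem s″ (addr f b) ≡ p′ b
        rows b j<b b≤ 0<p with m≤n⇒m<n∨m≡n j<b
        ... | inj₂ refl = ⊥-elim (<-irrefl (sym v≡0) 0<p)
        ... | inj₁ sj<b = P.rows sj<b b≤ 0<p
    ... | inj₂ (0<v , prev′ , mem≡′) = record { inv = inv ; cur≡ = trans (K rCur refl) cur≡ ; back = back }
      where
      i = suc n ∸ v
      linked-mem : (ℕ → ℕ) → ℕ → ℕ
      linked-mem μ = write (2 + addr f I.m) (addr f (suc j))
                       (write (addr g i) (suc n ∸ suc j) (write (addr f (suc j)) v μ))
      mem′ : mem s′ ≡ linked-mem (mem s₀)
      mem′ = trans mem≡′ (cong linked-mem mem≡)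
      inv : Inv (suc j) s′
      inv = record
        { N≡ = trans (K rN refl) (trans N≡ I.N≡) ; end≡ = trans (K rEnd refl) (trans end≡ I.end≡)
        ; arg≡ = trans (K rArg refl) (trans arg≡ I.arg≡) ; hold≡ = trans (K rHold refl) hold≡
        ; last≡ = λ _ → Emitted.last≡ E ; m = suc j ; m≤ = ≤-refl ; prev≡ = prev′
        ; same = λ {b} {e} b> e< → trans (cong (λ μ → μ (e + addr f b)) mem′)
            (miss-index f f I.m b 2<4 e< (λ eq → <-irrefl eq (≤-<-trans I.m≤ (<⇒≤ b>))) ↯
             miss-half g f i b 0<4 e< (λ eq → f≢g (sym eq)) ↯
             miss-index f f (suc j) b 0<4 e< (λ eq → <-irrefl eq b>) ↯ I.same (<⇒≤ b>) e<)
        ; rows′ = λ {b} → rows′ b }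
        where
        hit : write (addr g i) (suc n ∸ suc j) (write (addr f (suc j)) v (mem s₀)) (addr g i) ≡ q′ i
        hit = trans (write-hit (addr g i)) (sym (mirrors z<s j<n 0<v))
        rows′ : ∀ b → 0 < b → b ≤ suc j → 0 < p′ b → mem s′ (addr g (suc n ∸ p′ b)) ≡ q′ (suc n ∸ p′ b)
        rows′ b 0<b b≤ 0<p = trans (cong (λ μ → μ (addr g (suc n ∸ p′ b))) mem′)
            (miss-cell f g I.m (suc n ∸ p′ b) 2<4 0<4 (λ ()) ↯ go)
          where
          go : write (addr g i) (suc n ∸ suc j) (write (addr f (suc j)) v (mem s₀)) (addr g (suc n ∸ p′ b)) ≡ q′ (suc n ∸ p′ b)
          -- If an earlier column mirrors to the index `i` too, the fresh write is right as well: by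
          -- `mirrors` it stores `q′ i`, which depends on the index alone.
          go with i ≟ suc n ∸ p′ b | m≤n⇒m<n∨m≡n b≤
          ... | yes eq | _ rewrite sym eq = hit
          ... | no neq | inj₂ refl = ⊥-elim (neq refl)
          ... | no neq | inj₁ (s≤s b≤j) = miss-index g g i (suc n ∸ p′ b) 0<4 0<4 neq ↯
                 miss-half f g (suc j) (suc n ∸ p′ b) 0<4 0<4 f≢g ↯ I.rows′ 0<b b≤j 0<p
      at-m : mem s′ (2 + addr f I.m) ≡ addr f (suc j)
      at-m = trans (cong (λ μ → μ (2 + addr f I.m)) mem′) (write-hit (2 + addr f I.m))
      at-row : mem s′ (addr f (suc j)) ≡ v
      at-row = trans (cong (λ μ → μ (addr f (suc j))) mem′)
        (miss-cell f f I.m (suc j) 2<4 0<4 (λ ()) ↯ miss-half g f i (suc j) 0<4 0<4 (λ e → f≢g (sym e)) ↯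
         write-hit (addr f (suc j)))
      -- The last node is now that of column j + 1, so the link just made in node `m` is among the
      -- cells that the rest of the pass preserves.
      m≢ : ∀ {b} → b ≤ j → addr f b ≢ regs s′ rPrev
      m≢ {b} b≤ e = miss-index f f (suc j) b 0<4 0<4 (later b≤) (sym (trans e prev′))
      back : ∀ {s″} → Post (suc j) s′ s″ → Post j s₀ s″
      back {s″} P = record
        { N≡ = P.N≡ ; hold≡ = P.hold≡
        ; chain = subst (Chain n f (mem s″) p′ j) (sym linked)
            (take 0<v (subst (λ r → Chain n f (mem s″) p′ (suc j) (mem s″ (2 + r))) prev′ P.chain))
        ; rows = λ {b} → rows b ; rows′ = P.rows′
        ; frame = frame-trans (λ b≤ _ → m≢ b≤)
            (subst₂ (λ r μ → Frame j r (mem s₀) μ) (sym I.prev≡) (sym mem′) (link-frame {j} {I.m} {i = i})) P.frame }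
        where
        module P = Post P
        linked : mem s″ (2 + regs s₀ rPrev) ≡ addr f (suc j)
        linked = trans (cong (λ r → mem s″ (2 + r)) I.prev≡)
          (trans (next₁ P.frame (m≤n⇒m≤1+n I.m≤) (m≢ I.m≤)) at-m)
        rows : ∀ b → j < b → b ≤ n → 0 < p′ b → mem s″ (addr f b) ≡ p′ b
        rows b j<b b≤ 0<p with m≤n⇒m<n∨m≡n j<b
        ... | inj₂ refl = trans (row P.frame ≤-refl) at-row
        ... | inj₁ sj<b = P.rows sj<b b≤ 0<p

  read-exec : ∀ {j} s → j < n → regs s rCur ≡ addr f (suc j) →
              Exec read s 6 λ s′ → regs s′ rVal ≡ mem s (addr f (suc j)) × regs s′ rT ≡ mem s (3 + addr f (suc j)) ×
                regs s′ rPos ≡ addr f (suc j) × regs s′ rCur ≡ mem s (2 + addr f (suc j)) × mem s′ ≡ mem s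
  read-exec {j} s j<n cur≡ = exec read
    ( cur<S 0 0<4 , cur<W 3 3<4 , cur<S 3 3<4 , cur<W 0 0<4 , cur<W 2 2<4 , cur<S 2 2<4
    , cong (mem s) cur≡ , cong (λ a → mem s (3 + a)) cur≡ , cur≡ , cong (λ a → mem s (2 + a)) cur≡ , refl )
    where
    cur<S : ∀ e → e < 4 → e + regs s rCur < 8 * suc n
    cur<S e e< = subst (λ a → e + a < 8 * suc n) (sym cur≡) (cell-bound {n} f j<n e<)
    cur<W : ∀ e → e < 4 → e + regs s rCur < W
    cur<W e e< = subst (λ a → e + a < W) (sym cur≡) (cell<W f j<n e<)

  exchange-exec : ∀ {v h} s → regs s rVal ≡ v → regs s rHold ≡ h → v < W → h < W →
                  Exec exchange s 3 λ s′ → regs s′ rVal ≡ h × regs s′ rHold ≡ v × mem s′ ≡ mem s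
  exchange-exec s v≡ h≡ v< h< = exec exchange
    (subst (_< W) (sym h≡) h< , subst (_< W) (sym v≡) v< , subst (_< W) (sym h≡) h< , h≡ , v≡ , refl)

  select-exec : ∀ {j} s → j < n → regs s rT ≡ c j → regs s rArg ≡ x → regs s rVal ≡ p (suc j) → regs s rHold ≡ H j →
                Exec select s 5 λ s′ → regs s′ rVal ≡ p′ (suc j) × regs s′ rHold ≡ H (suc j) × mem s′ ≡ mem s
  select-exec {j} s j<n t≡ arg≡ val≡ hold≡ = exec-if {T = 4}
    (λ eq → exec-map (n≤1+n 3) (swapped (cong (_∨ (p (suc j) <ᵇ H j)) (trans (sym (cong₂ _≡ᵇ_ t≡ arg≡)) eq))) exchanged)
    λ neq → let c≢ = trans (sym (cong₂ _≡ᵇ_ t≡ arg≡)) neq in exec-if {T = 3}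
      (λ lt → exec-map ≤-refl
        (swapped (trans (cong (_∨ (p (suc j) <ᵇ H j)) c≢) (trans (sym (cong₂ _<ᵇ_ val≡ hold≡)) lt))) exchanged)
      (λ ge → exec-map (s≤s z≤n) (λ { _ refl →
          let eq = trans (cong (_∨ (p (suc j) <ᵇ H j)) c≢) (trans (sym (cong₂ _<ᵇ_ val≡ hold≡)) ge) in
          trans val≡ (sym (proj₁ (swap-no {j} eq))) , trans hold≡ (sym (proj₂ (swap-no {j} eq))) , refl })
        (exec skip {s} {_≡ s} refl))
    where
    p< : p (suc j) < W
    p< = index<W (≤-trans (p≤ (suc j)) (m≤n⇒m≤1+n j<n))
    H< : H j < W
    H< = index<W (≤-trans (Comb.hold≤ c x p p≤ j) (m≤n⇒m≤1+n (<⇒≤ j<n)))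
    exchanged = exchange-exec s val≡ hold≡ p< H<
    swapped : swaps x (c j) (p (suc j)) (H j) ≡ true → ∀ s′ →
              regs s′ rVal ≡ H j × regs s′ rHold ≡ p (suc j) × mem s′ ≡ mem s →
              regs s′ rVal ≡ p′ (suc j) × regs s′ rHold ≡ H (suc j) × mem s′ ≡ mem s
    swapped eq _ (v≡ , h≡ , m≡) = trans v≡ (sym (proj₁ (swap-yes {j} eq))) , trans h≡ (sym (proj₂ (swap-yes {j} eq))) , m≡

  consume-exec : ∀ {j} s → j < n → Inv j s → regs s rCur ≡ addr f (suc j) → 0 < p (suc j) →
                 Exec (consume g) s 26 (Stepped j (μ₀ (2 + addr f (suc j))) s)
  consume-exec {j} s j<n I cur≡ 0<p = exec-⨾ (exec-keeps (read-exec s j<n cur≡))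
    λ { s₁ ((v₁ , t₁ , pos₁ , cur₁ , m₁) , k₁) → exec-⨾
      (exec-keeps (select-exec s₁ j<n (trans t₁ (trans (I.same ≤-refl 3<4) (chars j<n))) (trans (k₁ rArg refl) I.arg≡)
        (trans v₁ (trans (I.same ≤-refl 0<4) (rows₀ j<n 0<p))) (trans (k₁ rHold refl) I.hold≡)))
      λ { s₂ ((v₂ , h₂ , m₂) , k₂) → emit-step s₂ j<n I (trans m₂ m₁)
            (trans (k₂ rN refl) (k₁ rN refl)) (trans (k₂ rEnd refl) (k₁ rEnd refl))
            (trans (k₂ rArg refl) (k₁ rArg refl)) (trans (k₂ rPrev refl) (k₁ rPrev refl))
            (trans (k₂ rCur refl) (trans cur₁ (I.same ≤-refl 2<4))) (trans (k₂ rPos refl) pos₁) v₂ h₂ } }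
    where module I = Inv I

  place-exec : ∀ {j} s → j < n → Inv j s → 0 < H j → p (suc j) ≡ 0 →
               Exec (place g) s 18 (Stepped j (regs s rCur) s)
  place-exec {j} s j<n I 0<H p≡0 = exec-⨾
    (exec-keeps (exec release {s}
      {λ s₁ → regs s₁ rVal ≡ H j × regs s₁ rHold ≡ 0 × regs s₁ rPos ≡ addr f (suc j) × mem s₁ ≡ mem s}
      ( subst (_< W) (sym I.hold≡) (index<W (≤-trans (Comb.hold≤ c x p p≤ j) (m≤n⇒m≤1+n (<⇒≤ j<n))))
      , index<W z≤n
      , subst (λ a → 8 + a < W) (sym (I.last≡ 0<H)) (cell<W f j<n 0<4)
      , I.hold≡ , refl , cong (8 +_) (I.last≡ 0<H) , refl )))
    λ { s₁ ((v₁ , h₁ , pos₁ , m₁) , k₁) → emit-step s₁ j<n I m₁ (k₁ rN refl) (k₁ rEnd refl) (k₁ rArg refl) (k₁ rPrev refl)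
          (k₁ rCur refl) pos₁ (trans v₁ (sym (proj₁ (gap-swap p≡0)))) (trans h₁ (sym (proj₂ (gap-swap p≡0)))) }
    where module I = Inv I

  private
    rT-inv : ∀ {j s v} → Inv j s → Inv j (setReg rT v s)
    rT-inv I = record
      { N≡ = I.N≡ ; end≡ = I.end≡ ; arg≡ = I.arg≡ ; hold≡ = I.hold≡ ; last≡ = I.last≡ ; m = I.m ; m≤ = I.m≤
      ; prev≡ = I.prev≡ ; same = I.same ; rows′ = I.rows′ }
      where module I = Inv I

    rT-stepped : ∀ {j a s v s′} → Stepped j a (setReg rT v s) s′ → Stepped j a s s′
    rT-stepped S = record
      { inv = Stepped.inv S ; cur≡ = Stepped.cur≡ S
      ; back = λ P → let module P = Post (Stepped.back S P) in record
          { N≡ = P.N≡ ; hold≡ = P.hold≡ ; chain = P.chain ; rows = P.rows ; rows′ = P.rows′ ; frame = P.frame } }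

    following-exec : ∀ {j} s → j ≤ n → Inv j s → 0 < H j →
                Exec following s 1 (_≡ setReg rT (8 + regs s rLast) s)
    following-exec s j≤n I 0<H = exec following
      (subst (λ a → 8 + a < W) (sym (Inv.last≡ I 0<H)) (8+addr<W f j≤n) , refl)

    hold-true : ∀ {j s} → Inv j s → (0 <ᵇ regs s rHold) ≡ true → 0 < H j
    hold-true I pos = subst (0 <_) (Inv.hold≡ I) (<ᵇ-true pos)

    hold-false : ∀ {j s} → Inv j s → (0 <ᵇ regs s rHold) ≡ false → H j ≡ 0
    hold-false I zer = n≤0⇒n≡0 (subst (_≤ 0) (Inv.hold≡ I) (<ᵇ-false zer))

  -- A nonempty hand has `rLast` at column j, so `following` yields `rCur` itself and the test leads
  -- to `consume`.
  body-take : ∀ {j} s → j < n → Inv j s → regs s rCur ≡ addr f (suc j) → 0 < p (suc j) →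
              Exec (body g) s 29 (Stepped j (μ₀ (2 + addr f (suc j))) s)
  body-take {j} s j<n I cur≡ 0<p = exec-if {T = 28}
    (λ pos → exec-⨾ (following-exec s (<⇒≤ j<n) I (hold-true I pos)) λ { s₁ refl → exec-if
      (λ lt → ⊥-elim (<-irrefl (trans (cong (8 +_) (Inv.last≡ I (hold-true I pos))) (sym cur≡)) (<ᵇ-true lt)))
      (λ _ → exec-map ≤-refl (λ _ → rT-stepped) (consume-exec s₁ j<n (rT-inv I) cur≡ 0<p)) })
    (λ _ → exec-map (m≤n+m 26 2) (λ _ q → q) (consume-exec s j<n I cur≡ 0<p))

  body-place : ∀ {j} s → j < n → Inv j s → 0 < H j → p (suc j) ≡ 0 → addr f (suc (suc j)) ≤ regs s rCur →
               Exec (body g) s 29 (Stepped j (regs s rCur) s)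
  body-place {j} s j<n I 0<H p≡0 cur≥ = exec-if {T = 28}
    (λ pos → exec-⨾ (following-exec s (<⇒≤ j<n) I 0<H) λ { s₁ refl → exec-if
      (λ lt → exec-map (m≤n+m 18 8) (λ _ → rT-stepped) (place-exec s₁ j<n (rT-inv I) 0<H p≡0))
      (λ ge → ⊥-elim (<⇒≱ (subst (_< regs s rCur) (sym (cong (8 +_) (Inv.last≡ I 0<H)))
                            (<-≤-trans (addr-< f (n<1+n (suc j))) cur≥)) (<ᵇ-false ge))) })
    (λ zer → ⊥-elim (<-irrefl (sym (hold-false I zer)) 0<H))

  gap-inv : ∀ {j s} → H j ≡ 0 → p (suc j) ≡ 0 → Inv j s → Inv (suc j) s
  gap-inv {j} {s} H≡0 p≡0 I = record
    { N≡ = I.N≡ ; end≡ = I.end≡ ; arg≡ = I.arg≡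
    ; hold≡ = trans I.hold≡ (trans H≡0 (sym (proj₂ (gap-swap p≡0))))
    ; last≡ = λ 0<H → ⊥-elim (<-irrefl (sym (proj₂ (gap-swap p≡0))) 0<H)
    ; m = I.m ; m≤ = m≤n⇒m≤1+n I.m≤ ; prev≡ = I.prev≡
    ; same = λ b> → I.same (<⇒≤ b>)
    ; rows′ = λ {b} → rows′ b }
    where
    module I = Inv I
    rows′ : ∀ b → 0 < b → b ≤ suc j → 0 < p′ b → mem s (addr g (suc n ∸ p′ b)) ≡ q′ (suc n ∸ p′ b)
    rows′ b 0<b b≤ 0<p with m≤n⇒m<n∨m≡n b≤
    ... | inj₂ refl = ⊥-elim (<-irrefl (sym (trans (proj₁ (gap-swap p≡0)) H≡0)) 0<p)
    ... | inj₁ (s≤s b≤j) = I.rows′ 0<b b≤j 0<p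

  gap-post : ∀ {j s s′} → H j ≡ 0 → p (suc j) ≡ 0 → Post (suc j) s s′ → Post j s s′
  gap-post {j} {s} {s′} H≡0 p≡0 P = record
    { N≡ = P.N≡ ; hold≡ = P.hold≡ ; chain = skip p′≡0 P.chain
    ; rows = λ {b} → rows b ; rows′ = P.rows′ ; frame = frame-weaken P.frame }
    where
    module P = Post P
    p′≡0 : p′ (suc j) ≡ 0
    p′≡0 = trans (proj₁ (gap-swap p≡0)) H≡0
    rows : ∀ b → j < b → b ≤ n → 0 < p′ b → mem s′ (addr f b) ≡ p′ b
    rows b j<b b≤ 0<p with m≤n⇒m<n∨m≡n j<b
    ... | inj₂ refl = ⊥-elim (<-irrefl (sym p′≡0) 0<p)
    ... | inj₁ sj<b = P.rows sj<b b≤ 0<p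

  -- No nodes remain, and by the hypothesis on `H` any columns left are gaps met with an empty hand;
  -- only the null pointer is to be written.
  close-exec : ∀ {j} s → Chain n f μ₀ p j 0 → (0 < H j → j ≡ n) → Inv j s → Exec close s 2 (Post j s)
  close-exec {j} s (skip p≡0 C) H→ I = exec-map ≤-refl (λ _ → gap-post H≡0 p≡0)
    (close-exec s C (λ 0<H → ⊥-elim (<-irrefl (sym (proj₂ (gap-swap p≡0))) 0<H)) (gap-inv H≡0 p≡0 I))
    where
    H≡0 : H j ≡ 0
    H≡0 = n≤0⇒n≡0 (≮⇒≥ λ 0<H → <-irrefl (H→ 0<H) (chain-≤ C))
  close-exec s end H→ I = exec-map ≤-refl post (exec-keeps (exec close {s} {λ s′ → mem s′ ≡ μ′}
      ( subst (λ a → 2 + a < W) (sym I.prev≡) (cell<W f I.m≤ 2<4)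
      , subst (λ a → 2 + a < 8 * suc n) (sym I.prev≡) (cell-bound {n} f I.m≤ 2<4)
      , index<W z≤n
      , setMem-write {s = setReg rT (2 + regs s rPrev) s} (cong (2 +_) I.prev≡) refl refl )))
    where
    module I = Inv I
    μ′ = write (2 + addr f I.m) 0 (mem s)
    post : ∀ s′ → mem s′ ≡ μ′ × Keeps close s s′ → Post n s s′
    post s′ (m≡ , K) = record
      { N≡ = trans (K rN refl) I.N≡ ; hold≡ = trans (K rHold refl) I.hold≡
      ; chain = subst (Chain n f (mem s′) p′ n)
          (sym (trans (cong₂ (λ μ a → μ (2 + a)) m≡ I.prev≡) (write-hit (2 + addr f I.m)))) end
      ; rows = λ n<b b≤n _ → ⊥-elim (<⇒≱ n<b b≤n)
      ; rows′ = λ {b} 0<b b≤ 0<p → trans (cong (λ μ → μ (addr g (suc n ∸ p′ b))) m≡)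
          (miss-cell f g I.m (suc n ∸ p′ b) 2<4 0<4 (λ ()) ↯ I.rows′ 0<b b≤ 0<p)
      ; frame = subst₂ (λ r μ → Frame n r (mem s) μ) (sym I.prev≡) (sym m≡) record
          { key = λ h b → miss-cell f h I.m b 2<4 1<4 (λ ()) ↯ refl
          ; char = λ h b → miss-cell f h I.m b 2<4 3<4 (λ ()) ↯ refl
          ; next = λ b → miss-half f g I.m b 2<4 2<4 f≢g ↯ refl
          ; row = λ {b} b≤ → miss-cell f f I.m b 2<4 0<4 (λ ()) ↯ refl
          ; next₁ = λ b≤ ne → (λ e → ne (sym (+-cancelˡ-≡ 2 _ _ e))) ↯ refl } }

  -- A hand that is still full after column n is not placed, since `rLast` has reached `rEnd`; its
  -- row stays in `rHold` for `splice`.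
  finish-close : ∀ {j} s → Chain n f μ₀ p j 0 → (0 < H j → j ≡ n) → Inv j s → Exec (finish g) s 22 (Post j s)
  finish-close {j} s C H→ I = exec-⨾ {T = 20}
    (exec-if {T = 19}
      (λ pos → exec-if {T = 18}
        (λ lt → ⊥-elim (<-irrefl (trans (Inv.last≡ I (hold-true I pos))
          (trans (cong (addr f) (H→ (hold-true I pos))) (sym (Inv.end≡ I)))) (<ᵇ-true lt)))
        (λ _ → exec-map (s≤s z≤n) (λ _ e → e) (exec skip {s} {_≡ s} refl)))
      (λ _ → exec-map (s≤s z≤n) (λ _ e → e) (exec skip {s} {_≡ s} refl)))
    λ { _ refl → close-exec s C H→ I }

  finish-place : ∀ {j} s → p (suc j) ≡ 0 → Chain n f μ₀ p (suc j) 0 → 0 < H j → Inv j s → Exec (finish g) s 22 (Post j s)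
  finish-place {j} s p≡0 C 0<H I = exec-⨾ {T = 20}
    (exec-if {T = 19}
      (λ _ → exec-if {T = 18}
        (λ _ → place-exec s (chain-≤ C) I 0<H p≡0)
        (λ ge → ⊥-elim (<⇒≱ (subst₂ _<_ (sym (Inv.last≡ I 0<H)) (sym (Inv.end≡ I)) (addr-< f (chain-≤ C))) (<ᵇ-false ge))))
      (λ zer → ⊥-elim (<-irrefl (sym (hold-false I zer)) 0<H)))
    λ s₁ S → exec-map ≤-refl (λ _ → Stepped.back S)
      (close-exec s₁ C (λ 0<H → ⊥-elim (<-irrefl (sym (proj₂ (gap-swap p≡0))) 0<H)) (Stepped.inv S))

  private
    -- 30 is a test plus at most 29 steps of `body`; 23 is the last test plus 22 steps of `finish`.
    -- The potential counts a node twice, because consuming it may fill the hand, and emptying the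
    -- hand takes another iteration.
    tick : ∀ {k l} → suc k ≤ l → suc (29 + (30 * k + 23)) ≤ 30 * l + 23
    tick {k} {l} k<l = begin
      30 + (30 * k + 23) ≡⟨ +-assoc 30 (30 * k) 23 ⟨
      30 + 30 * k + 23   ≡⟨ cong (_+ 23) (*-suc 30 k) ⟨
      30 * suc k + 23    ≤⟨ +-monoˡ-≤ 23 (*-monoʳ-≤ 30 k<l) ⟩
      30 * l + 23        ∎
      where open ≤-Reasoning

  -- An iteration either consumes a node of the old list or empties the hand.
  pass-exec : ∀ {j a} s (C : Chain n f μ₀ p j a) → regs s rCur ≡ a → Inv j s →
              Exec (pass g) s (30 * (2 * takes C + above 0 (H j)) + 23) (Post j s)
  pass-exec {j} s end cur≡ I = exec-map (m≤n+m 23 (30 * (0 + above 0 (H j)))) (λ _ q → q)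
    (exec-done (cong (0 <ᵇ_) cur≡) (finish-close s end (λ _ → refl) I))
  pass-exec {j} s (take 0<p C) cur≡ I = exec-map time (λ _ q → q)
    (exec-again (cong (0 <ᵇ_) cur≡) (body-take s (chain-≤ C) I cur≡ 0<p)
      λ s₁ S → exec-map ≤-refl (λ _ → Stepped.back S) (pass-exec s₁ C (Stepped.cur≡ S) (Stepped.inv S)))
    where
    time : suc (29 + (30 * (2 * takes C + above 0 (H (suc j))) + 23)) ≤ 30 * (2 * suc (takes C) + above 0 (H j)) + 23
    time = tick (begin
      suc (2 * takes C + above 0 (H (suc j))) ≤⟨ s≤s (+-monoʳ-≤ (2 * takes C) (above≤1 0 (H (suc j)))) ⟩
      suc (2 * takes C + 1)                   ≡⟨ cong suc (+-comm (2 * takes C) 1) ⟩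
      2 + 2 * takes C                         ≡⟨ *-suc 2 (takes C) ⟨
      2 * suc (takes C)                       ≤⟨ m≤m+n _ (above 0 (H j)) ⟩
      2 * suc (takes C) + above 0 (H j)       ∎)
      where open ≤-Reasoning
  pass-exec {j} {a} s (skip p≡0 C) cur≡ I with 0 <? H j
  ... | no H≯0 = exec-map time (λ _ → gap-post H≡0 p≡0) (pass-exec s C cur≡ (gap-inv H≡0 p≡0 I))
    where
    H≡0 : H j ≡ 0
    H≡0 = n≤0⇒n≡0 (≮⇒≥ H≯0)
    time : 30 * (2 * takes C + above 0 (H (suc j))) + 23 ≤ 30 * (2 * takes C + above 0 (H j)) + 23
    time = ≤-reflexive (cong (λ h → 30 * (2 * takes C + above 0 h) + 23) (trans (proj₂ (gap-swap p≡0)) (sym H≡0)))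
  ... | yes 0<H with chain-addr C
  ...   | inj₁ refl = exec-map (m≤n+m 23 (30 * (2 * takes C + above 0 (H j)))) (λ _ q → q)
            (exec-done (cong (0 <ᵇ_) cur≡) (finish-place s p≡0 C 0<H I))
  ...   | inj₂ a≥ = exec-map time (λ _ q → q)
            (exec-again (trans (cong (0 <ᵇ_) cur≡) (true-<ᵇ {0} (≤-trans (s≤s z≤n) a≥)))
              (body-place s (chain-≤ C) I 0<H p≡0 (subst (addr f (suc (suc j)) ≤_) (sym cur≡) a≥))
              λ s₁ S → exec-map ≤-refl (λ _ → Stepped.back S)
                (pass-exec s₁ C (trans (Stepped.cur≡ S) cur≡) (Stepped.inv S)))
    where
    time : suc (29 + (30 * (2 * takes C + above 0 (H (suc j))) + 23)) ≤ 30 * (2 * takes C + above 0 (H j)) + 23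
    time = tick (≤-reflexive (trans (sym (+-suc (2 * takes C) _))
      (cong (2 * takes C +_) (trans (cong suc (above-≥ (≤-reflexive (proj₂ (gap-swap p≡0))))) (sym (above-< 0<H))))))

-- The deletion from the second list

above-0 : ∀ {v w} → above 0 v ≡ above 0 w → v ≡ 0 → w ≡ 0
above-0 eq v≡0 = n≤0⇒n≡0 (above-≡0 (trans (sym eq) (above-≥ (≤-reflexive v≡0))))

above-pos : ∀ {v w} → above 0 v ≡ above 0 w → 0 < v → 0 < w
above-pos eq 0<v = above-≡1 (trans (sym eq) (above-< 0<v))

-- A chain depends on `p` only through its support, and on the memory only through the `next` cells
-- of later columns.
chain-map : ∀ {n h μ μ′ p p′ j a} → Chain n h μ p j a →
            (∀ b → j < b → b ≤ n → above 0 (p b) ≡ above 0 (p′ b)) →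
            (∀ b → j < b → μ′ (2 + addr h b) ≡ μ (2 + addr h b)) → Chain n h μ′ p′ j a
chain-map end _ _ = end
chain-map (skip p≡0 C) sup nxt = skip (above-0 (sup _ ≤-refl (chain-≤ C)) p≡0)
  (chain-map C (λ b j<b → sup b (<⇒≤ j<b)) λ b j<b → nxt b (<⇒≤ j<b))
chain-map {n} {h} {μ} {μ′} {p} {p′} {j} (take 0<p C) sup nxt = take (above-pos (sup _ ≤-refl (chain-≤ C)) 0<p)
  (subst (Chain n h μ′ p′ (suc j)) (sym (nxt (suc j) ≤-refl))
    (chain-map C (λ b j<b → sup b (<⇒≤ j<b)) λ b j<b → nxt b (<⇒≤ j<b)))

module Splice (n W : ℕ) (big : 16 * suc n ≤ W) (g : Fin 2) (q q′ μ₀ : ℕ → ℕ) (k : ℕ) (k≤n : k ≤ n)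
              (q-k : 0 < q k) (q′-k : q′ k ≡ 0)
              (stays : ∀ b → 0 < b → b ≤ n → b ≢ k → above 0 (q b) ≡ above 0 (q′ b)) where

  open Arithmetic n W big
  open Machine (8 * suc n) W {12}

  private
    0<4 : 0 < 4
    0<4 = z<s
    2<4 : 2 < 4
    2<4 = s≤s (s≤s z<s)

    next≢ : ∀ b b′ → b ≢ b′ → 2 + addr g b ≢ 2 + addr g b′
    next≢ b b′ b≢ eq = b≢ (proj₂ (proj₂ (cell-injective {h = g} {g} {b} {b′} 2<4 2<4 eq)))

    chain-bound : ∀ {j a} → Chain n g μ₀ q j a → a < W
    chain-bound end = index<W z≤n
    chain-bound (skip _ C) = chain-bound C
    chain-bound (take _ C) = cell<W g (chain-≤ C) 0<4

  -- The whole loop writes one cell, the `next` cell of node `at`; its position shows that the links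
  -- of nodes passed earlier survive.
  record Spliced (m j : ℕ) (s′ : State 12) : Set where
    field
      chain  : Chain n g (mem s′) q′ j (mem s′ (2 + addr g m))
      at     : ℕ
      value  : ℕ
      mem≡   : mem s′ ≡ write (2 + addr g at) value μ₀
      at-pos : at ≡ m ⊎ j < at

  cut-exec : ∀ {j m} s → Chain n g μ₀ q (suc j) (μ₀ (2 + addr g (suc j))) → suc j ≡ k → m ≤ j →
             mem s ≡ μ₀ → regs s rCur ≡ addr g (suc j) → regs s rPrev ≡ addr g m → Exec cut s 4 (Spliced m j)
  cut-exec {j} {m} s C refl m≤j refl cur≡ prev≡ = exec-map ≤-refl post (exec cut {s} {λ s′ → mem s′ ≡ μ′}
    ( subst (λ a → 2 + a < W) (sym cur≡) (cell<W g k≤n 2<4)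
    , subst (λ a → 2 + a < 8 * suc n) (sym cur≡) (cell-bound {n} g k≤n 2<4)
    , subst (λ a → 2 + a < W) (sym prev≡) (cell<W g m≤n 2<4)
    , subst (λ a → 2 + a < 8 * suc n) (sym prev≡) (cell-bound {n} g m≤n 2<4)
    , subst (λ a → mem s (2 + a) < W) (sym cur≡) (chain-bound C)
    , setMem-write {s = s} (cong (2 +_) prev≡) (cong (λ a → mem s (2 + a)) cur≡) refl ))
    where
    m≤n = ≤-trans m≤j (<⇒≤ k≤n)
    μ′ = write (2 + addr g m) (mem s (2 + addr g (suc j))) (mem s)
    post : ∀ s′ → mem s′ ≡ μ′ → Spliced m j s′
    post s′ mem≡ = record
      { chain = skip q′-k (subst (Chain n g (mem s′) q′ (suc j))
          (sym (trans (cong (λ μ → μ (2 + addr g m)) mem≡) (write-hit (2 + addr g m))))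
          (chain-map C (λ b j<b b≤n → stays b (≤-trans (s≤s z≤n) j<b) b≤n λ { refl → <-irrefl refl j<b })
            λ b j<b → trans (cong (λ μ → μ (2 + addr g b)) mem≡)
              (write-miss (next≢ m b λ { refl → <-irrefl refl (≤-trans (s≤s m≤j) (<⇒≤ j<b)) }))))
      ; at = m ; value = mem s (2 + addr g (suc j)) ; mem≡ = mem≡ ; at-pos = inj₁ refl }

  -- Column `k` is nonzero in `q`, so the walk meets its node, and the address test stops exactly
  -- there. The costs are 4 for a test and `advance`, and 5 for the last test and `cut`.
  splice-loop-exec : ∀ {j a m} s (C : Chain n g μ₀ q j a) → j < k → m ≤ j → μ₀ (2 + addr g m) ≡ a →
    mem s ≡ μ₀ → regs s rCur ≡ a → regs s rPrev ≡ addr g m → regs s rT ≡ addr g k →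
    Exec (splice-loop g) s (4 * takes C + 5) (Spliced m j)
  splice-loop-exec s end j<k = ⊥-elim (<⇒≱ j<k k≤n)
  splice-loop-exec {j} {a} {m} s (skip q≡0 C) j<k m≤j link≡ mem≡ cur≡ prev≡ t≡ =
    exec-map ≤-refl post (splice-loop-exec s C (≤∧≢⇒< j<k sj≢k) (m≤n⇒m≤1+n m≤j) link≡ mem≡ cur≡ prev≡ t≡)
    where
    sj≢k : suc j ≢ k
    sj≢k refl = <-irrefl (sym q≡0) q-k
    post : ∀ s′ → Spliced m (suc j) s′ → Spliced m j s′
    post s′ S = record
      { chain = skip (above-0 (stays (suc j) z<s (chain-≤ C) sj≢k) q≡0) (Spliced.chain S)
      ; at = Spliced.at S ; value = Spliced.value S ; mem≡ = Spliced.mem≡ S ; at-pos = at-pos (Spliced.at-pos S) }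
      where
      at-pos : ∀ {b} → b ≡ m ⊎ suc j < b → b ≡ m ⊎ j < b
      at-pos (inj₁ e) = inj₁ e
      at-pos (inj₂ l) = inj₂ (<⇒≤ l)
  splice-loop-exec {j} {a} {m} s (take 0<q C) j<k m≤j link≡ mem≡ cur≡ prev≡ t≡ with suc j ≟ k
  ... | yes sj≡k = exec-map (m≤n+m 5 (4 * suc (takes C))) (λ _ e → e)
        (exec-done (false-<ᵇ (≤-reflexive (trans t≡ (trans (cong (addr g) (sym sj≡k)) (sym cur≡)))))
          (cut-exec s C sj≡k m≤j mem≡ cur≡ prev≡))
  ... | no sj≢k = exec-map (≤-reflexive (cong (_+ 5) (sym (*-suc 4 (takes C))))) post
        (exec-again (true-<ᵇ (subst₂ _<_ (sym cur≡) (sym t≡) (addr-< g sj<k)))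
          (exec-keeps (exec advance {s}
            {λ s₁ → mem s₁ ≡ μ₀ × regs s₁ rCur ≡ μ₀ (2 + addr g (suc j)) × regs s₁ rPrev ≡ addr g (suc j)}
            ( subst (_< W) (sym cur≡) (cell<W g (chain-≤ C) 0<4)
            , subst (λ a → 2 + a < W) (sym cur≡) (cell<W g (chain-≤ C) 2<4)
            , subst (λ a → 2 + a < 8 * suc n) (sym cur≡) (cell-bound {n} g (chain-≤ C) 2<4)
            , mem≡ , cong₂ (λ μ a → μ (2 + a)) mem≡ cur≡ , cur≡ )))
          λ { s₁ ((mem₁ , cur₁ , prev₁) , k₁) →
            splice-loop-exec s₁ C sj<k ≤-refl refl mem₁ cur₁ prev₁ (trans (k₁ rT refl) t≡) })
    where
    sj<k : suc j < k
    sj<k = ≤∧≢⇒< j<k sj≢k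
    post : ∀ s′ → Spliced (suc j) (suc j) s′ → Spliced m j s′
    post s′ S = record
      { chain = subst (Chain n g (mem s′) q′ j)
          (sym (trans (cong (λ μ → μ (2 + addr g m)) (Spliced.mem≡ S))
            (trans (write-miss (next≢ (Spliced.at S) m λ e →
              <-irrefl (sym e) (≤-<-trans m≤j (at> (Spliced.at-pos S))))) link≡)))
          (take (above-pos (stays (suc j) z<s (chain-≤ C) sj≢k) 0<q) (Spliced.chain S))
      ; at = Spliced.at S ; value = Spliced.value S ; mem≡ = Spliced.mem≡ S ; at-pos = inj₂ (at> (Spliced.at-pos S)) }
      where
      at> : ∀ {b} → b ≡ suc j ⊎ suc j < b → j < b
      at> (inj₁ refl) = ≤-refl
      at> (inj₂ l)    = <⇒≤ l

-- The data structure

-- The row cells of nodes outside the list hold junk.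
record Half (n : ℕ) (c : ℕ → ℕ) (h : Fin 2) (p μ : ℕ → ℕ) : Set where
  field
    key   : ∀ {b} → b < n → μ (1 + addr h (suc b)) ≡ suc b
    char  : ∀ {b} → b < n → μ (3 + addr h (suc b)) ≡ c b
    row   : ∀ {b} → b < n → 0 < p (suc b) → μ (addr h (suc b)) ≡ p (suc b)
    chain : Chain n h μ p 0 (μ (2 + addr h 0))

module _ {σ : ℕ} where

  mirror-reverse : ∀ {A B : String σ} {p q} → Pivots A B p → Pivots (reverse A) (reverse B) q →
                   ∀ {i} → 0 < i → i ≤ length B → 0 < q i → p (suc (length B) ∸ q i) ≡ suc (length B) ∸ i
  mirror-reverse {A} {B} {p} {q} P Q {i} =
    subst (λ n → 0 < i → i ≤ n → 0 < q i → p (suc n ∸ q i) ≡ suc n ∸ i) (List.length-reverse B)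
      (mirror Q (subst₂ (λ A B → Pivots A B p) (sym (List.reverse-involutive A)) (sym (List.reverse-involutive B)) P))

  module Update {A B : String σ} (W : ℕ) (big : 16 * suc (length B) ≤ W) (f g : Fin 2) (f≢g : f ≢ g) (x : Fin σ)
                {p q q′ : ℕ → ℕ} (P : Pivots A B p) (Q : Pivots (reverse A) (reverse B) q)
                (Q′ : Pivots (reverse (A ∷ʳ x)) (reverse B) q′) where

    private
      n = length B
      c = charAt B
      p′ = comb c (toℕ x) p
      H = hold c (toℕ x) p

      P′ : Pivots (A ∷ʳ x) B p′
      P′ = Pivots-comb P x

      module Other = Exit x P Q Q′

    open Arithmetic n W big
    open Machine (8 * suc n) W {12}
    open Emit n W big f g using (mirror-addr-exec)

    Spliced : (μ μ′ : ℕ → ℕ) → Set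
    Spliced μ μ′ = Chain n g μ′ q′ 0 (μ′ (2 + addr g 0)) ×
      (∀ e h b → e < 4 → e ≢ 2 ⊎ h ≢ g → μ′ (e + addr h b) ≡ μ (e + addr h b))

    splice-exec : ∀ s → regs s rN ≡ suc n → regs s rHold ≡ H n → (C : Chain n g (mem s) q 0 (mem s (2 + addr g 0))) →
                  Exec (splice g) s (13 + 4 * takes C) λ s′ → Spliced (mem s) (mem s′)
    splice-exec s N≡ hold≡ C = exec-if {T = 12 + 4 * takes C} some none
      where
      k = suc n ∸ H n
      none : (0 <ᵇ regs s rHold) ≡ false → Exec skip s (12 + 4 * takes C) λ s′ → Spliced (mem s) (mem s′)
      -- For an empty hand the mirrored index is n + 1, which is no column, so the support does not
      -- change.
      none zer = exec-map (s≤s z≤n) (λ { _ refl →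
          chain-map C (λ b 0<b b≤n → sym (Other.stay 0<b b≤n λ e →
            <-irrefl (trans e (cong (suc n ∸_) H≡0)) (s≤s b≤n))) (λ _ _ → refl) , λ _ _ _ _ _ → refl })
        (exec skip {s} {_≡ s} refl)
        where
        H≡0 : H n ≡ 0
        H≡0 = n≤0⇒n≡0 (subst (_≤ 0) hold≡ (<ᵇ-false zer))
      some : (0 <ᵇ regs s rHold) ≡ true →
             Exec (mirror-addr (reg rHold) g ⨾ rPrev ≔ val (lit (off g)) ⨾ load rCur (lit (2 + off g)) ⨾ splice-loop g)
                  s (12 + 4 * takes C) λ s′ → Spliced (mem s) (mem s′)
      some pos = exec-map (≤-reflexive (cong (7 +_) (+-comm (4 * takes C) 5))) post (exec-⨾
        (exec-keeps (mirror-addr-exec g (reg rHold) s N≡ hold≡))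
        λ { s₁ ((t₁ , m₁) , k₁) → exec-⨾
          (exec (rPrev ≔ val (lit (off g))) {s₁} {_≡ setReg rPrev (off g) s₁} (cell<W g {0} {0} z≤n z<s , refl))
          λ { s₂ refl → exec-⨾
            (exec-keeps (exec (load rCur (lit (2 + off g))) {s₂}
              {λ s₃ → regs s₃ rCur ≡ mem s (2 + addr g 0) × mem s₃ ≡ mem s}
              (cell-bound {n} g {0} {2} z≤n (s≤s (s≤s z<s)) , cong (λ μ → μ (2 + addr g 0)) m₁ , m₁)))
            λ { s₃ ((c₃ , m₃) , k₃) → S.splice-loop-exec s₃ C 0<k z≤n refl m₃ c₃ (k₃ rPrev refl) (trans (k₃ rT refl) t₁) } } })
        where
        0<H : 0 < H n
        0<H = subst (0 <_) hold≡ (<ᵇ-true pos)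
        H≤n : H n ≤ n
        H≤n = Comb.hold≤ c (toℕ x) p (bounded P) n
        0<k : 0 < k
        0<k = m<n⇒0<n∸m (s≤s H≤n)
        k≤n : k ≤ n
        k≤n = s≤s⁻¹ (∸-monoʳ-< {o = 0} 0<H (m≤n⇒m≤1+n H≤n))
        exits = Other.exit 0<k k≤n refl
        module S = Splice n W big g q q′ (mem s) k k≤n (proj₂ exits) (proj₁ exits)
                     (λ b 0<b b≤n b≢k → sym (Other.stay 0<b b≤n b≢k))
        post : ∀ s′ → S.Spliced 0 0 s′ → Spliced (mem s) (mem s′)
        post s′ X = S.Spliced.chain X , λ e h b e<4 other →
          trans (cong (λ μ → μ (e + addr h b)) (S.Spliced.mem≡ X)) (write-miss (miss e h b e<4 other))
          where
          miss : ∀ e h b → e < 4 → e ≢ 2 ⊎ h ≢ g → 2 + addr g (S.Spliced.at X) ≢ e + addr h b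
          miss e h b e<4 other eq with cell-injective {h = g} {h} {S.Spliced.at X} {b} (s≤s (s≤s z<s)) e<4 eq | other
          ... | refl , _ , _ | inj₁ e≢ = e≢ refl
          ... | _ , refl , _ | inj₂ h≢ = h≢ refl

    module _ (s : State 12) (N≡ : regs s rN ≡ suc n) (arg≡ : regs s rArg ≡ toℕ x)
             (F : Half n c f p (mem s)) (G : Half n (charAt (reverse B)) g q (mem s)) where

      module F = Half F
      module G = Half G
      open Pass n W big f g f≢g c (toℕ x) p q′ (bounded P) (mirror P′ Q′) (mem s) F.key F.char F.row
        using (Inv; Post; module Frame; pass-exec)
      open Frame

      start-exec : Exec (mirror-addr (lit 1) f ⨾ setup f) s 10 λ s′ →
        Inv 0 s′ × regs s′ rPrev ≡ addr f 0 × regs s′ rCur ≡ mem s (2 + addr f 0) × mem s′ ≡ mem s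
      start-exec = exec-⨾ (exec-keeps (mirror-addr-exec f (lit 1) s N≡ refl))
        λ { s₁ ((t₁ , m₁) , k₁) → exec-map ≤-refl
          (λ { s₂ ((e₂ , p₂ , h₂ , c₂ , m₂) , k₂) →
            record { N≡ = trans (k₂ rN refl) (trans (k₁ rN refl) N≡) ; end≡ = e₂
                   ; arg≡ = trans (k₂ rArg refl) (trans (k₁ rArg refl) arg≡) ; hold≡ = h₂ ; last≡ = λ ()
                   ; m = 0 ; m≤ = z≤n ; prev≡ = p₂
                   ; same = λ {b} {e} _ _ → cong (λ μ → μ (e + addr f b)) m₂
                   ; rows′ = λ 0<b b≤0 → ⊥-elim (<⇒≱ 0<b b≤0) }
            , p₂ , c₂ , m₂ })
          (exec-keeps (exec (setup f) {s₁}
            {λ s₂ → regs s₂ rEnd ≡ addr f n × regs s₂ rPrev ≡ addr f 0 × regs s₂ rHold ≡ 0 ×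
                    regs s₂ rCur ≡ mem s (2 + addr f 0) × mem s₂ ≡ mem s}
            ( subst (_< W) (sym t₁) (cell<W f ≤-refl z<s)
            , cell<W f {0} {0} z≤n z<s , cell<W f {0} {0} z≤n z<s , index<W z≤n
            , cell-bound {n} f {0} {2} z≤n (s≤s (s≤s z<s))
            , t₁ , refl , refl , cong (λ μ → μ (2 + addr f 0)) m₁ , m₁ ))) }

      update-exec : Exec (update f g) s (64 * suc (Δ A B)) λ s′ →
        regs s′ rN ≡ suc n × regs s′ rHead ≡ mem s′ 2 ×
        Half n c f p′ (mem s′) × Half n (charAt (reverse B)) g q′ (mem s′)
      update-exec = exec-map time (λ _ r → r) (exec-⨾ start-exec
        λ { s₁ (I , prev₁ , cur₁ , m₁) → exec-⨾ (pass-exec s₁ F.chain cur₁ I)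
          λ s₂ X → let G₂ = G-chain s₁ s₂ m₁ X in exec-⨾
            (exec-keeps (exec-map (≤-reflexive (cong (λ t → 13 + 4 * t) (G-takes G₂))) (λ _ r → r)
              (splice-exec s₂ (Post.N≡ X) (Post.hold≡ X) G₂)))
            λ { s₃ ((C₃ , other) , k₃) → exec (load rHead (lit 2))
              (cell-bound {n} zero {0} {2} z≤n (s≤s (s≤s z<s)) , trans (k₃ rN refl) (Post.N≡ X) , refl ,
                F-half s₁ s₂ m₁ X s₃ other prev₁ , G-half s₁ s₂ m₁ X s₃ other C₃) } })
        where
        G-takes : ∀ {μ a} (C : Chain n g μ q 0 a) → takes C ≡ Δ A B
        G-takes C = begin
          takes C          ≡⟨ +-identityʳ (takes C) ⟨
          takes C + 0      ≡⟨ takes-count C ⟩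
          count q 0 n      ≡⟨ cong (count q 0) (List.length-reverse B) ⟨
          count q 0 (length (reverse B)) ≡⟨ Pivots-size Q ⟩
          Δ (reverse A) (reverse B) ≡⟨ Δ-reverse A B ⟩
          Δ A B            ∎
          where open ≡-Reasoning
        F-takes : takes F.chain ≡ Δ A B
        F-takes = trans (trans (sym (+-identityʳ _)) (takes-count F.chain)) (Pivots-size P)
        -- In all 47 + 64 Δ: per node, twice 30 for `pass` and 4 for `splice`; 47 collects 10 for
        -- the setup, 23 and 13 for the constant parts of the two walks, and 1 for reloading the
        -- head.
        time : 10 + ((30 * (2 * takes F.chain + 0) + 23) + ((13 + 4 * Δ A B) + 1)) ≤ 64 * suc (Δ A B)
        time rewrite F-takes = ≤-trans (≤-reflexive (solve 1 (λ d →
            con 10 :+ ((con 30 :* (con 2 :* d :+ con 0) :+ con 23) :+ ((con 13 :+ con 4 :* d) :+ con 1))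
              := con 47 :+ con 64 :* d) refl (Δ A B)))
          (≤-trans (+-monoˡ-≤ (64 * Δ A B) (m≤m+n 47 17)) (≤-reflexive (sym (*-suc 64 (Δ A B)))))
          where open ℕ.+-*-Solver
        module _ (s₁ s₂ : State 12) (m₁ : mem s₁ ≡ mem s) (X : Post 0 s₁ s₂) where
          module X = Post X
          back : ∀ {a v} → mem s₂ a ≡ mem s₁ a → mem s a ≡ v → mem s₂ a ≡ v
          back {a} e₂ e = trans e₂ (trans (cong (λ μ → μ a) m₁) e)
          G-chain : Chain n g (mem s₂) q 0 (mem s₂ (2 + addr g 0))
          G-chain = subst (Chain n g (mem s₂) q 0) (sym (back (next X.frame 0) refl))
            (chain-map G.chain (λ _ _ _ → refl) λ b _ → back (next X.frame b) refl)
          module _ (s₃ : State 12)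
                   (other : ∀ e h b → e < 4 → e ≢ 2 ⊎ h ≢ g → mem s₃ (e + addr h b) ≡ mem s₂ (e + addr h b)) where
            F-half : regs s₁ rPrev ≡ addr f 0 → Half n c f p′ (mem s₃)
            F-half prev₁ = record
              { key = λ {b} b<n → trans (other 1 f (suc b) (s≤s z<s) (inj₂ f≢g)) (back (key X.frame f (suc b)) (F.key b<n))
              ; char = λ {b} b<n → trans (other 3 f (suc b) (s≤s (s≤s (s≤s z<s))) (inj₂ f≢g))
                  (back (char X.frame f (suc b)) (F.char b<n))
              ; row = λ {b} b<n 0<p → trans (other 0 f (suc b) z<s (inj₂ f≢g)) (X.rows z<s b<n 0<p)
              ; chain = subst (Chain n f (mem s₃) p′ 0)
                  (trans (cong (λ a → mem s₂ (2 + a)) prev₁) (sym (other 2 f 0 (s≤s (s≤s z<s)) (inj₂ f≢g))))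
                  (chain-map X.chain (λ _ _ _ → refl) λ b _ → other 2 f b (s≤s (s≤s z<s)) (inj₂ f≢g)) }
            G-half : Chain n g (mem s₃) q′ 0 (mem s₃ (2 + addr g 0)) → Half n (charAt (reverse B)) g q′ (mem s₃)
            G-half C₃ = record
              { key = λ {b} b<n → trans (other 1 g (suc b) (s≤s z<s) (inj₁ λ ())) (back (key X.frame g (suc b)) (G.key b<n))
              ; char = λ {b} b<n → trans (other 3 g (suc b) (s≤s (s≤s (s≤s z<s))) (inj₁ λ ()))
                  (back (char X.frame g (suc b)) (G.char b<n))
              ; row = λ {b} b<n 0<q → trans (other 0 g (suc b) z<s (inj₁ λ ())) (row′ b<n 0<q)
              ; chain = C₃ }
              where
              -- A nonzero column of `q′` mirrors to a nonzero column `j` of `p′`, for which the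
              -- pass has written the mirrored row; mirroring once more leads back. So no row of the
              -- second list is left stale.
              row′ : ∀ {b} → b < n → 0 < q′ (suc b) → mem s₂ (addr g (suc b)) ≡ q′ (suc b)
              row′ {b} b<n 0<q = subst (λ i → mem s₂ (addr g i) ≡ q′ i) i≡ (X.rows′ 0<j j≤n 0<p)
                where
                j = suc n ∸ q′ (suc b)
                q≤n : q′ (suc b) ≤ n
                q≤n = ≤-trans (bounded Q′ (suc b)) b<n
                0<j : 0 < j
                0<j = m<n⇒0<n∸m (s≤s q≤n)
                j≤n : j ≤ n
                j≤n = s≤s⁻¹ (∸-monoʳ-< {o = 0} 0<q (m≤n⇒m≤1+n q≤n))
                p≡ : p′ j ≡ suc n ∸ suc b
                p≡ = mirror-reverse P′ Q′ z<s b<n 0<q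
                0<p : 0 < p′ j
                0<p = subst (0 <_) (sym p≡) (m<n⇒0<n∸m b<n)
                i≡ : suc n ∸ p′ j ≡ suc b
                i≡ = trans (cong (suc n ∸_) p≡) (m∸[m∸n]≡n (m≤n⇒m≤1+n b<n))

-- From chains to lists of pivotal points

module _ {n : ℕ} {p μ : ℕ → ℕ} (p≤ : ∀ j → p j ≤ j)
         (key : ∀ {b} → b < n → μ (1 + addr zero (suc b)) ≡ suc b)
         (row : ∀ {b} → b < n → 0 < p (suc b) → μ (addr zero (suc b)) ≡ p (suc b)) where

  -- Uniqueness comes from the columns, which increase along the chain.
  chain-list : ∀ {j a} → Chain n zero μ p j a → ∃ λ (ps : List (Fin n × Fin n)) →
    LinkedList (8 * suc n) μ a ps × Unique ps ×
    (∀ i k → (i , k) ∈ ps ⇔ (j ≤ toℕ k × p (suc (toℕ k)) ≡ suc (toℕ i)))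
  chain-list end = [] , nil , [] , λ i k → mk⇔ (λ ()) λ (n≤k , _) → ⊥-elim (<⇒≱ (Fin.toℕ<n k) n≤k)
  chain-list {j} (skip p≡0 C) with chain-list C
  ... | ps , ll , u , iff = ps , ll , u , λ i k → mk⇔
      (λ ∈ps → let (j<k , eq) = Equivalence.to (iff i k) ∈ps in <⇒≤ j<k , eq)
      (λ (j≤k , eq) → Equivalence.from (iff i k) (≤∧≢⇒< j≤k (λ { refl → 0≢1+n (trans (sym p≡0) eq) }) , eq))
  chain-list {j} (take 0<p C) with chain-list C
  ... | ps , ll , u , iff = (i₀ , k₀) ∷ ps ,
      node z<s (subst (_< 8 * suc n) (+-comm 2 _) (cell-bound {n} zero j<n (s≤s (s≤s z<s))))
        (trans (row j<n 0<p) p≡)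
        (trans (cong μ (+-comm _ 1)) (trans (key j<n) (cong suc (sym k≡))))
        (subst (λ a → LinkedList (8 * suc n) μ (μ a) ps) (+-comm 2 _) ll) ,
      All.tabulate (λ { {i , k} ∈ps refl → <-irrefl (sym k≡) (proj₁ (Equivalence.to (iff i k) ∈ps)) }) ∷ u ,
      λ i k → mk⇔ (to i k) (from i k)
    where
    j<n : j < n
    j<n = chain-≤ C
    pred-p<n : pred (p (suc j)) < n
    pred-p<n = ≤-trans (≤-reflexive (suc-pred (p (suc j)) ⦃ >-nonZero 0<p ⦄)) (≤-trans (p≤ (suc j)) j<n)
    i₀ k₀ : Fin n
    i₀ = fromℕ< pred-p<n
    k₀ = fromℕ< j<n
    k≡ : toℕ k₀ ≡ j
    k≡ = Fin.toℕ-fromℕ< j<n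
    p≡ : p (suc j) ≡ suc (toℕ i₀)
    p≡ = trans (sym (suc-pred (p (suc j)) ⦃ >-nonZero 0<p ⦄)) (cong suc (sym (Fin.toℕ-fromℕ< pred-p<n)))
    to : ∀ i k → (i , k) ∈ (i₀ , k₀) ∷ ps → j ≤ toℕ k × p (suc (toℕ k)) ≡ suc (toℕ i)
    to i k (here refl) = ≤-reflexive (sym k≡) , trans (cong (λ z → p (suc z)) k≡) p≡
    to i k (there ∈ps) = let (j<k , eq) = Equivalence.to (iff i k) ∈ps in <⇒≤ j<k , eq
    from : ∀ i k → j ≤ toℕ k × p (suc (toℕ k)) ≡ suc (toℕ i) → (i , k) ∈ (i₀ , k₀) ∷ ps
    from i k (j≤k , eq) with m≤n⇒m<n∨m≡n j≤k
    ... | inj₁ j<k = there (Equivalence.from (iff i k) (j<k , eq))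
    ... | inj₂ j≡k = here (cong₂ _,_
            (Fin.toℕ-injective (suc-injective (trans (sym eq) (trans (cong (λ z → p (suc z)) (sym j≡k)) p≡))))
            (Fin.toℕ-injective (trans (sym j≡k) (sym k≡))))

module _ {σ : ℕ} where

  half-encodes : ∀ {A B : String σ} {p μ} → Pivots A B p → Half (length B) (charAt B) zero p μ →
                 Encodes (8 * suc (length B)) μ (μ 2) (𝒦 A B)
  half-encodes P F with chain-list (bounded P) (Half.key F) (Half.row F) (Half.chain F)
  ... | ps , ll , u , iff = ps , ll , u , λ (i , k) → mk⇔
      (λ ∈ps → Equivalence.from (pivotal⇔ P i k) (proj₂ (Equivalence.to (iff i k) ∈ps)))
      (λ piv → Equivalence.from (iff i k) (z≤n , Equivalence.to (pivotal⇔ P i k) piv))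

  -- Appending to `A` prepends to `reverse A`, for which combing gives no rule, so the new function
  -- of the second half is produced by combing the whole string anew. It serves as a specification;
  -- the program obtains its values by mirroring.
  pivots : (A B : String σ) → ∃ (Pivots A B)
  pivots A B = subst (λ A → ∃ (Pivots A B)) (List.reverse-involutive A) (go (reverse A))
    where
    go : ∀ R → ∃ (Pivots (reverse R) B)
    go []      = _ , Pivots-[] B
    go (x ∷ R) = subst (λ A → ∃ (Pivots A B)) (sym (List.unfold-reverse x R)) (_ , Pivots-comb (proj₂ (go R)) x)

  -- The base is n + 2 because n may be 0. Four factors supply 16 and a fifth n + 1, as the
  -- addresses require; the σ further ones make room for the characters, since 2 to the power σ
  -- exceeds σ.
  word : String σ → ℕ
  word B = (length B + 2) ^ (5 + σ)

  word-big : ∀ B → 16 * suc (length B) ≤ word B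
  word-big B = begin
    16 * suc n                     ≤⟨ *-mono-≤ (^-monoˡ-≤ 4 (m≤n+m 2 n)) (s≤s (m≤m+n n 1)) ⟩
    (n + 2) ^ 4 * suc (n + 1)      ≡⟨ cong ((n + 2) ^ 4 *_) (sym (+-suc n 1)) ⟩
    (n + 2) ^ 4 * (n + 2)          ≤⟨ *-monoˡ-≤ (n + 2) (^-monoʳ-≤ (n + 2) ⦃ n+2≢0 ⦄ (m≤m+n 4 σ)) ⟩
    (n + 2) ^ (4 + σ) * (n + 2)    ≡⟨ *-comm _ (n + 2) ⟩
    (n + 2) ^ (5 + σ)              ∎
    where
    open ≤-Reasoning
    n = length B
    n+2≢0 : NonZero (n + 2)
    n+2≢0 = >-nonZero (≤-trans z<s (m≤n+m 2 n))

  σ<word : ∀ B → suc σ ≤ word B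
  σ<word B = begin
    suc σ              ≤⟨ <2^ σ ⟩
    2 ^ σ              ≤⟨ ^-monoˡ-≤ σ (m≤n+m 2 n) ⟩
    (n + 2) ^ σ        ≤⟨ ^-monoʳ-≤ (n + 2) ⦃ >-nonZero (≤-trans z<s (m≤n+m 2 n)) ⦄ (m≤n+m σ 5) ⟩
    (n + 2) ^ (5 + σ)  ∎
    where
    open ≤-Reasoning
    n = length B
    <2^ : ∀ m → m < 2 ^ m
    <2^ zero    = z<s
    <2^ (suc m) = ≤-trans (s≤s (<2^ m))
      (≤-trans (+-monoˡ-≤ (2 ^ m) (m^n>0 2 m)) (≤-reflexive (cong (2 ^ m +_) (sym (+-identityʳ _)))))

  record Rep (A B : String σ) (s : State 12) : Set where
    field
      fits  : Fits (8 * suc (length B)) (word B) s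
      N≡    : regs s rN ≡ suc (length B)
      head≡ : regs s rHead ≡ mem s 2
      p q   : ℕ → ℕ
      P     : Pivots A B p
      Q     : Pivots (reverse A) (reverse B) q
      F     : Half (length B) (charAt B) zero p (mem s)
      G     : Half (length B) (charAt (reverse B)) (suc zero) q (mem s)

  -- The reversals enter through equations: for prepending the two orientations are exchanged, and
  -- `reverse (reverse A)` equals `A` only propositionally.
  update-pivots : ∀ {A B Ā B̄ Ā′ : String σ} {n p q} W f g → f ≢ g → (x : Fin σ) → 16 * suc n ≤ W →
    n ≡ length B → Ā ≡ reverse A → B̄ ≡ reverse B → Ā′ ≡ reverse (A ∷ʳ x) → Pivots A B p → Pivots Ā B̄ q →
    ∀ s → regs s rN ≡ suc n → regs s rArg ≡ toℕ x → Half n (charAt B) f p (mem s) → Half n (charAt B̄) g q (mem s) →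
    ∃ λ p′ → ∃ λ q′ → Pivots (A ∷ʳ x) B p′ × Pivots Ā′ B̄ q′ ×
      Machine.Exec (8 * suc n) W (update f g) s (64 * suc (Δ A B)) λ s′ →
        regs s′ rN ≡ suc n × regs s′ rHead ≡ mem s′ 2 × Half n (charAt B) f p′ (mem s′) × Half n (charAt B̄) g q′ (mem s′)
  update-pivots {A} {B} W f g f≢g x big refl refl refl refl P Q s N≡ arg≡ F G =
    _ , _ , Pivots-comb P x , proj₂ Q′ , Update.update-exec W big f g f≢g x P Q (proj₂ Q′) s N≡ arg≡ F G
    where Q′ = pivots (reverse (A ∷ʳ x)) (reverse B)

  fits-arg : ∀ {B s} (x : Fin σ) →
    Fits (8 * suc (length B)) (word B) s → Fits (8 * suc (length B)) (word B) (setReg rArg (toℕ x) s)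
  fits-arg {B} {s} x = Machine.setReg-fits (8 * suc (length B)) (word B) {s = s} rArg
    (≤-trans (Fin.toℕ<n x) (<⇒≤ (σ<word B)))

  module _ (A B : String σ) (s : State 12) (R : Rep A B s) (x : Fin σ) where

    open Machine (8 * suc (length B)) (word B) {12}
    private module R = Rep R

    append-rep : Exec (update zero (suc zero)) (setReg rArg (toℕ x) s) (64 * suc (Δ A B)) (Rep (A ∷ʳ x) B)
    append-rep = let (p′ , q′ , P′ , Q′ , E) = update-pivots (word B) zero (suc zero) (λ ()) x (word-big B) refl refl refl refl
                                                 R.P R.Q (setReg rArg (toℕ x) s) R.N≡ refl R.F R.G
      in exec-map ≤-refl (λ s′ (fits , N≡ , head≡ , F′ , G′) →
           record { fits = fits ; N≡ = N≡ ; head≡ = head≡ ; P = P′ ; Q = Q′ ; F = F′ ; G = G′ })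
         (exec-fits (fits-arg {B} {s} x R.fits) E)

    -- Appending to `reverse A` with the halves exchanged; by `Δ-reverse` the time bound is the
    -- same.
    prepend-rep : Exec (update (suc zero) zero) (setReg rArg (toℕ x) s) (64 * suc (Δ A B)) (Rep (x ∷ A) B)
    prepend-rep = let (q′ , p′ , Q′ , P′ , E) = update-pivots (word B) (suc zero) zero (λ ()) x (word-big B)
                                                  (sym (List.length-reverse B)) (sym (List.reverse-involutive A))
                                                  (sym (List.reverse-involutive B)) A′≡
                                                  R.Q R.P (setReg rArg (toℕ x) s) R.N≡ refl R.G R.F
      in exec-map (≤-reflexive (cong (λ d → 64 * suc d) (Δ-reverse A B))) (λ s′ (fits , N≡ , head≡ , G′ , F′) →
           record { fits = fits ; N≡ = N≡ ; head≡ = head≡ ; P = P′ ; F = F′ ; G = G′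
                  ; Q = subst (λ A → Pivots A (reverse B) q′) (sym (List.unfold-reverse x A)) Q′ })
         (exec-fits (fits-arg {B} {s} x R.fits) E)
      where
      A′≡ : x ∷ A ≡ reverse (reverse A ∷ʳ x)
      A′≡ = trans (sym (List.reverse-involutive (x ∷ A))) (cong reverse (List.unfold-reverse x A))

-- The initial memory for the empty `A`

quotient-remainder : ∀ d .⦃ _ : NonZero d ⦄ {r} m → r < d → (r + m * d) / d ≡ m × (r + m * d) % d ≡ r
quotient-remainder d {r} m r<d =
  trans (+-distrib-/-∣ʳ r (n∣m*n m)) (cong₂ _+_ (m<n⇒m/n≡0 r<d) (m*n/n≡m m d)) ,
  trans ([m+kn]%n≡m%n r m d) (m<n⇒m%n≡m r<d)

module _ {σ : ℕ} (B : String σ) where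

  private
    n = length B

    halfString : ℕ → String σ
    halfString zero    = B
    halfString (suc _) = reverse B

  -- The contents of cell c of the node at address m * 4, which is node m / 2 of half m % 2.
  initial-cell : ℕ → ℕ → ℕ
  initial-cell m 0 = m / 2
  initial-cell m 1 = m / 2
  initial-cell m 2 = if m / 2 <ᵇ n then 8 + m * 4 else 0
  initial-cell m _ = charAt (halfString (m % 2)) (pred (m / 2))

  initial-mem : ℕ → ℕ
  initial-mem a = initial-cell (a / 4) (a % 4)

  initial-regs : Reg → ℕ
  initial-regs (suc zero)       = initial-mem 2
  initial-regs (suc (suc zero)) = suc n
  initial-regs _                = 0

  initial-mem-addr : ∀ h j {c} → c < 4 → initial-mem (c + addr h j) ≡ initial-cell (toℕ h + j * 2) c
  initial-mem-addr h j {c} c<4 rewrite addr≡ h j =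
    let (q≡ , r≡) = quotient-remainder 4 (toℕ h + j * 2) c<4 in cong₂ initial-cell q≡ r≡

  private
    halves : ∀ (h : Fin 2) j → (toℕ h + j * 2) / 2 ≡ j × (toℕ h + j * 2) % 2 ≡ toℕ h
    halves h j = quotient-remainder 2 j (Fin.toℕ<n h)

  initial-next : ∀ h j → initial-mem (2 + addr h j) ≡ (if j <ᵇ n then addr h (suc j) else 0)
  initial-next h j = trans (initial-mem-addr h j (s≤s (s≤s z<s)))
    (cong₂ (λ i a → if i <ᵇ n then 8 + a else 0) (proj₁ (halves h j)) (sym (addr≡ h j)))

  initial-chain : ∀ h d j → d + j ≡ n → Chain n h initial-mem (λ b → b) j (initial-mem (2 + addr h j))
  initial-chain h zero    j refl = subst (Chain n h initial-mem (λ b → b) n)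
    (sym (trans (initial-next h n) (cong (if_then addr h (suc n) else 0) (false-<ᵇ {n} ≤-refl)))) end
  initial-chain h (suc d) j eq = subst (Chain n h initial-mem (λ b → b) j)
    (sym (trans (initial-next h j) (cong (if_then addr h (suc j) else 0) (true-<ᵇ j<n))))
    (take z<s (initial-chain h d (suc j) (trans (+-suc d j) eq)))
    where
    j<n : j < n
    j<n = subst (suc j ≤_) eq (s≤s (m≤n+m j d))

  initial-half : ∀ h → Half n (charAt (halfString (toℕ h))) h (λ b → b) initial-mem
  initial-half h = record
    { key = λ {b} _ → trans (initial-mem-addr h (suc b) (s≤s z<s)) (proj₁ (halves h (suc b)))
    ; char = λ {b} _ → trans (initial-mem-addr h (suc b) (s≤s (s≤s (s≤s z<s))))
        (cong₂ (λ i r → charAt (halfString r) (pred i)) (proj₁ (halves h (suc b))) (proj₂ (halves h (suc b))))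
    ; row = λ {b} _ _ → trans (initial-mem-addr h (suc b) z<s) (proj₁ (halves h (suc b)))
    ; chain = initial-chain h n 0 (+-identityʳ n) }

  private
    cell< : ∀ {a} → a < 8 * suc n → ∀ m c → m * 4 ≤ a → initial-cell m c < word B
    cell< {a} a< m c m≤ = go c
      where
      below : ∀ {i} → i ≤ 8 + a → i < word B
      below {i} i≤ = <-≤-trans (begin-strict
        i                      ≤⟨ i≤ ⟩
        8 + a                  <⟨ +-mono-≤-< (m≤m*n 8 (suc n)) a< ⟩
        8 * suc n + 8 * suc n  ≡⟨ *-distribʳ-+ (suc n) 8 8 ⟨
        16 * suc n             ∎) (word-big B)
        where open ≤-Reasoning
      half : m / 2 < word B
      half = below (≤-trans (m/n≤m m 2) (≤-trans (m≤m*n m 4) (≤-trans m≤ (m≤n+m a 8))))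
      go : ∀ c → initial-cell m c < word B
      go 0 = half
      go 1 = half
      go 2 with m / 2 <ᵇ n
      ... | true  = below (+-monoʳ-≤ 8 m≤)
      ... | false = below z≤n
      go (suc (suc (suc _))) = <-≤-trans (charAt< (halfString (m % 2)) (pred (m / 2))) (σ<word B)

  initial-fits : Fits (8 * suc n) (word B) ⟨ initial-regs , initial-mem ⟩
  initial-fits = regs< , mem<
    where
    mem< : ∀ a → a < 8 * suc n → initial-mem a < word B
    mem< a a< = cell< a< (a / 4) (a % 4) (m/n*n≤m a 4)
    small : ∀ {i} → i ≤ suc n → i < word B
    small = Arithmetic.index<W n (word B) (word-big B)
    regs< : ∀ r → initial-regs r < word B
    regs< zero                = small z≤n
    regs< (suc zero)          = mem< 2 (cell-bound {n} zero {0} {2} z≤n (s≤s (s≤s z<s)))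
    regs< (suc (suc zero))    = small ≤-refl
    regs< (suc (suc (suc _))) = small z≤n

  initial-rep : Rep [] B ⟨ initial-regs , initial-mem ⟩
  initial-rep = record
    { fits = initial-fits ; N≡ = refl ; head≡ = refl ; P = Pivots-[] B ; Q = Pivots-[] (reverse B)
    ; F = initial-half zero ; G = initial-half (suc zero) }

-- A state for an arbitrary `A` is reached from the initial one by running `prepend` for its
-- characters, the last one first.
rep-exists : ∀ {σ} (A B : String σ) → ∃ (Rep A B)
rep-exists []      B = _ , initial-rep B
rep-exists (x ∷ A) B = let (s , R) = rep-exists A B
                           (_ , s′ , _ , _ , R′) = prepend-rep A B s R x in s′ , R′

programs : UpdatePrograms
programs = record
  { k = 12 ; arg = rArg ; head = rHead ; prepend = update (suc zero) zero ; append = update zero (suc zero) }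

theorem3p8 :
    (σ : ℕ) →
    Σ[ P ∈ UpdatePrograms ] Σ[ spaceC ∈ ℕ ] Σ[ wordC ∈ ℕ ] Σ[ timeC ∈ ℕ ]
    let open UpdatePrograms P
        S : String σ → ℕ
        S B = spaceC * suc (length B)
        W : String σ → ℕ
        W B = (length B + 2) ^ wordC
    in
    Σ[ Rep ∈ (String σ → String σ → State k → Set) ]
      (∀ A B → ∃ λ s → Rep A B s)
      × (∀ A B s → Rep A B s →
           Fits (S B) (W B) s × Encodes (S B) (mem s) (regs s head) (𝒦 A B))
      × (∀ A B s → Rep A B s → (x : Fin σ) →
           ∃ λ t → ∃ λ s′ →
             Run (S B) (W B) prepend (setReg arg (toℕ x) s) t s′
             × t ≤ timeC * suc (Δ A B)
             × Rep (x ∷ A) B s′)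
      × (∀ A B s → Rep A B s → (x : Fin σ) →
           ∃ λ t → ∃ λ s′ →
             Run (S B) (W B) append (setReg arg (toℕ x) s) t s′
             × t ≤ timeC * suc (Δ A B)
             × Rep (A ∷ʳ x) B s′)
-- Space is eight cells for each index from 0 to n, four in either half; `5 + σ` is the exponent of
-- `word`, and 64 the factor in `update-exec`.
theorem3p8 σ = programs , 8 , 5 + σ , 64 , Rep , rep-exists ,
  (λ A B s R → Rep.fits R ,
    subst (λ p → Encodes (8 * suc (length B)) (mem s) p (𝒦 A B)) (sym (Rep.head≡ R)) (half-encodes (Rep.P R) (Rep.F R))) ,
  prepend-rep , append-rep
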